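{- Let $R$ be a conditional equational theory over $\Sigma^*$ and let $R=R_0,R_1,\ldots$ be a fair theorem proving derivation w.r.t. $\mathfrak{S}$. If $R$ can be finitely saturated under $\mathfrak{S}$ (i.e. the derivation is finite, $R=R_0,R_1,\ldots,R_n$, with limit $R_n$ a finite set of clauses), then the word problems w.r.t. $R$ are decidable; that is, there is a decision procedure determining, for given $s,t\in\Sigma^*$, whether or not $R\models s\approx t$.
   Context: **Strings and clauses.** $\Sigma$ is a finite alphabet with a total precedence, $\Sigma^*$ is the set of strings over $\Sigma$, $\lambda$ is the empty string. An equation is $s\approx t$ with $s,t\in\Sigma^*$ (unoriented: $s\approx t$ and $t\approx s$ are identified, likewise $s\not\approx t$ and $t\not\approx s$). A literal is an equation $s\approx t$ (positive) or a negated equation $s\not\approx t$ (negative). A clause over $\Sigma^*$ is a finite multiset of literals, written as a disjunction; $\square$ is the empty clause. A conditional equation is a clause $(s_1\approx t_1\wedge\cdots\wedge s_n\approx t_n)\rightarrow l\approx r$, $n\ge 0$, i.e. the clause $s_1\not\approx t_1\vee\cdots\vee s_n\not\approx t_n\vee l\approx r$. A conditional equational theory is a set of conditional equations. $\succ$ is the length-lexicographic ordering on $\Sigma^*$: $s\succ t$ iff $|s|>|t|$, or $|s|=|t|$ and $s$ is larger than $t$ in the lexicographic order induced by the precedence. $\bowtie$ denotes either $\approx$ or $\not\approx$. **Selection.** A fixed selection function selects (arbitrarily) exactly one negative literal in each clause containing at least one negative literal. **Inference system $\mathfrak{S}$.** It consists of the following rules. - Superposition: from $C\vee u_1u_2\approx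 s$ and $D\vee u_2u_3\approx t$ infer $C\vee D\vee u_1t\approx su_3$, if $u_2\neq\lambda$, $C$ and $D$ contain no selected literal, $u_1u_2\succ s$, $u_2u_3\succ t$. - Rewrite: from $C\vee u_1u_2u_3\bowtie s$ and $D\vee u_2\approx t$ infer $C\vee D\vee u_1tu_3\bowtie s$, if $u_1u_2u_3\bowtie s$ is selected in the left premise whenever $\bowtie$ is $\not\approx$, $C$ contains no selected literal whenever $\bowtie$ is $\approx$, $D$ contains no selected literal, $u_2\succ t$. - Equality Resolution: from $C\vee s\not\approx s$ infer $C$, if $s\not\approx s$ is selected in the premise. - Paramodulation: from $C\vee s\approx u_1u_2$ and $D\vee u_2u_3\approx t$ infer $C\vee D\vee su_3\approx u_1t$, if $u_2\ne\lambda$, $C$ contains no selected literal, $C$ contains a positive literal, $D$ contains no selected literal, $s\succ u_1u_2$, $u_2u_3\succ t$. - Factoring: from $C\vee s\approx t\vee su\approx tu$ infer $C\vee su\approx tu$, if $C$ contains no selected literal. (The last two rules play no role for Horn clauses.) **$g$-terms and $g$-clauses.** $T(\Sigma\cup\{\bot\})$ is the set of ground terms with each letter of $\Sigma$ a unary function symbol and $\bot$ the only constant; its elements ($g$-terms) are written as strings $u\bot$ with $u\in\Sigma^*$. For a clause $C=s_1\approx t_1\vee\cdots\vee s_m\approx t_m\vee u_1\not\approx v_1\vee\cdots\vee u_n\not\approx v_n$ over $\Sigma^*$, a $g$-clause of $C$ is any $s_1w_1\bot\approx t_1w_1\bot\vee\cdots\vee s_mw_m\bot\approx t_mw_m\bot\vee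 u_1\bot\not\approx v_1\bot\vee\cdots\vee u_n\bot\not\approx v_n\bot$ with $w_1,\ldots,w_m\in\Sigma^*$. $\succ_g$ is the length-lexicographic ordering on $g$-terms (precedence on $\Sigma$ extended with $\bot$ minimal), extended to literals and clauses by multiset extension, where $s\approx t$ is identified with $\{\{s\},\{t\}\}$, $s\not\approx t$ with $\{\{s,t\}\}$, and a clause with the multiset of its literals. **Semantics.** An (equality Herbrand) interpretation is a congruence $I$ on $T(\Sigma\cup\{\bot\})$ (the one generated by some set of equations between $g$-terms). It satisfies a $g$-clause if some positive literal $p\approx q$ of it has $(p,q)\in I$ or some negative literal $p\not\approx q$ has $(p,q)\notin I$. $I$ satisfies a clause over $\Sigma^*$ if it satisfies all its $g$-clauses, and a set of clauses if it satisfies every member. $R\models s\approx t$ means every interpretation satisfying $R$ satisfies $s\approx t$. For $g$-clauses, $\{C_1,\ldots,C_k\}\models C$ means every interpretation satisfying all $C_i$ satisfies $C$. **$g$-instances and redundancy.** A $g$-instance of an inference $\pi$ of $\mathfrak{S}$ with premises $C_1,\ldots,C_k$ and conclusion $D$ is an inference of $\mathfrak{S}$ with premises $C_1',\ldots,C_k'$ and conclusion $D'$ that are $g$-clauses of $C_1,\ldots,C_k,D$; here $g$-terms are viewed as strings over $\Sigma\cup\{\bot\}$, $\succ_g$ is used in place of $\succ$, all terms occurring must be $g$-terms, and a negative literal of $C_i'$ is selected iff the literal of $C_i$ it comes from is. A $g$-clause $C$ is redundant w.r.t. a set $S$ of clauses over $\Sigma^*$ if there are $g$-clauses $C_1',\ldots,C_k'$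 ($k\ge0$) of clauses in $S$ with $\{C_1',\ldots,C_k'\}\models C$ and $C\succ_g C_i'$ for all $i$. A clause is redundant w.r.t. $S$ if all its $g$-clauses are. An inference $\pi$ is redundant w.r.t. $S$ if for every $g$-instance of $\pi$ with maximal premise $C'$ (w.r.t. $\succ_g$) and conclusion $D'$ there are $g$-clauses $C_1',\ldots,C_k'$ of clauses in $S$ with $\{C_1',\ldots,C_k'\}\models D'$ and $C'\succ_g C_i'$ for all $i$. **Derivations.** A theorem proving derivation is a sequence $S_0,S_1,\ldots$ of sets of clauses over $\Sigma^*$ such that each $S_i$ ($i\geq 1$) is either $S_{i-1}\cup\{C\}$ where $C$ is the conclusion of an inference of $\mathfrak{S}$ with premises in $S_{i-1}$ (Deduction), or $S_{i-1}\setminus\{D\}$ where $D$ is redundant w.r.t. $S_{i-1}$ (Deletion). Its limit is $S_\infty=\bigcup_i\bigcap_{j\ge i}S_j$ (for a finite derivation $S_0,\ldots,S_n$ the limit is $S_n$). It is fair w.r.t. $\mathfrak{S}$ if every inference of $\mathfrak{S}$ with premises in $S_\infty$ is redundant w.r.t. $\bigcup_jS_j$. -}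

module Defs where

open import Data.Fin.Base using (Fin; zero; suc; inject₁; fromℕ)
open import Data.List.Base using (List; []; _∷_; _++_; map; foldr; length)
open import Data.List.Relation.Binary.Lex.Strict using (Lex-<)
open import Data.List.Relation.Binary.Pointwise using (Pointwise)
open import Data.List.Relation.Unary.All using (All)
open import Data.List.Relation.Unary.Any using (Any)
import Data.List.Relation.Binary.Permutation.Setoid as Permutation
open import Data.Maybe.Base as Maybe using (Maybe; just)
import Data.Maybe.Relation.Binary.Pointwise as Maybe using (Pointwise)
import Data.Maybe.Relation.Unary.All as Maybe using (All)
import Data.Maybe.Relation.Unary.Any as Maybe using (Any)
open import Data.Nat.Base as ℕ using (ℕ)
open import Data.Product.Base using (∃-syntax; _×_; _,_)
open import Data.Sum.Base using (_⊎_)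
open import Level using (0ℓ)
open import Relation.Binary.Bundles using (Setoid)
open import Relation.Binary.Core using (Rel)
import Relation.Binary.Construct.Add.Infimum.Strict as Infimum
open import Relation.Binary.Definitions using (_Respects_)
open import Relation.Binary.PropositionalEquality.Core using (_≡_; _≢_)
open import Relation.Binary.PropositionalEquality.Properties using (setoid)
open import Relation.Binary.Structures using (IsEquivalence)
open import Relation.Nullary.Construct.Add.Infimum using (_₋; ⊥₋; [_])
open import Relation.Nullary.Negation.Core using (¬_)
open import Relation.Unary using (Pred; _∈_; _⊆_; _∪_; _∖_; _≐_)

------------------------------------------------------------------------
-- Literals and clauses over an arbitrary set of terms

data Sign : Set where
  pos neg : Sign

data Literal (T : Set) : Set where
  lit : Sign → T → T → Literal T

pattern _≈_ s t = lit pos s t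
pattern _≉_ s t = lit neg s t

infix 4 _≈_ _≉_

data Positive {T : Set} : Pred (Literal T) 0ℓ where
  positive : ∀ {s t} → Positive (s ≈ t)

data Negative {T : Set} : Pred (Literal T) 0ℓ where
  negative : ∀ {s t} → Negative (s ≉ t)

-- Literals are unoriented.
infix 4 _≃_

data _≃_ {T : Set} : Rel (Literal T) 0ℓ where
  same : ∀ {L} → L ≃ L
  flip : ∀ {⋈ s t} → lit ⋈ s t ≃ lit ⋈ t s

≃-isEquivalence : ∀ {T} → IsEquivalence (_≃_ {T})
≃-isEquivalence = record { refl = same ; sym = ≃-sym ; trans = ≃-trans }
  where
  ≃-sym : ∀ {K L} → K ≃ L → L ≃ K
  ≃-sym same = same
  ≃-sym flip = flip

  ≃-trans : ∀ {K L M} → K ≃ L → L ≃ M → K ≃ M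
  ≃-trans same q    = q
  ≃-trans flip same = flip
  ≃-trans flip flip = same

literalSetoid : Set → Setoid 0ℓ 0ℓ
literalSetoid T = record { Carrier = Literal T ; isEquivalence = ≃-isEquivalence }

-- A multiset is a list considered up to permutation.
Clause : Set → Set
Clause T = List (Literal T)

infix 4 _∼_ _∈ᶜ_

_∼_ : ∀ {T} → Rel (Clause T) 0ℓ
_∼_ {T} = Permutation._↭_ (literalSetoid T)

_∈ᶜ_ : ∀ {T} → Literal T → Clause T → Set
L ∈ᶜ C = Any (L ≃_) C

mapLiteral : ∀ {T U} → (T → U) → Literal T → Literal U
mapLiteral f (lit ⋈ s t) = lit ⋈ (f s) (f t)

------------------------------------------------------------------------
-- Orderings

module LengthLex {A : Set} (_<_ : Rel A 0ℓ) where

  infix 4 _≻_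

  _≻_ : Rel (List A) 0ℓ
  s ≻ t = length t ℕ.< length s ⊎ (length s ≡ length t × Lex-< _≡_ _<_ t s)

module MultisetExtension (S : Setoid 0ℓ 0ℓ) (_≻_ : Rel (Setoid.Carrier S) 0ℓ) where

  open Permutation S using (_↭_)

  record _≻ᵐ_ (M N : List (Setoid.Carrier S)) : Set where
    field
      kept removed added : List (Setoid.Carrier S)
      removed-nonempty   : removed ≢ []
      M-split            : M ↭ kept ++ removed
      N-split            : N ↭ kept ++ added
      dominated          : All (λ y → Any (_≻ y) removed) added

module ClauseOrder {T : Set} (_≻_ : Rel T 0ℓ) where

  literalMultiset : Literal T → List (List T)
  literalMultiset (s ≈ t) = (s ∷ []) ∷ (t ∷ []) ∷ []
  literalMultiset (s ≉ t) = (s ∷ t ∷ []) ∷ []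

  open Permutation using (↭-setoid)

  private
    termSetoid = setoid T
    module M₁ = MultisetExtension termSetoid _≻_
    module M₂ = MultisetExtension (↭-setoid termSetoid) M₁._≻ᵐ_
    module M₃ = MultisetExtension (↭-setoid (↭-setoid termSetoid)) M₂._≻ᵐ_

  infix 4 _≻ᶜ_

  _≻ᶜ_ : Rel (Clause T) 0ℓ
  C ≻ᶜ D = map literalMultiset C M₃.≻ᵐ map literalMultiset D

------------------------------------------------------------------------
-- The inference system

-- A clause together with its selected literal, if any.  Occurrences of the
-- same literal in a multiset being interchangeable, the selected occurrence
-- is recorded by its value.
record Premise (T : Set) : Set where
  constructor premise
  field
    clause   : Clause T
    selected : Maybe (Literal T)

open Premise public

mapPremise : ∀ {T U} → (T → U) → Premise T → Premise U
mapPremise f (premise C L) = premise (map (mapLiteral f) C) (Maybe.map (mapLiteral f) L)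

IsSelectedIn : ∀ {T} → Literal T → Premise T → Set
IsSelectedIn L P = Maybe.Any (L ≃_) (selected P)

NoneSelectedIn : ∀ {T} → Clause T → Premise T → Set
NoneSelectedIn C P = Maybe.All (λ L → ¬ (L ∈ᶜ C)) (selected P)

-- The system is parametrised by the alphabet and its precedence, since it is
-- used both over Σ and over Σ ∪ {⊥}.
module Inference {A : Set} (_<_ : Rel A 0ℓ) where

  open LengthLex _<_

  data Infer : List (Premise (List A)) → Clause (List A) → Set where

    superposition : ∀ {P Q E} C D u₁ u₂ u₃ s t →
      clause P ∼ (u₁ ++ u₂ ≈ s) ∷ C →
      clause Q ∼ (u₂ ++ u₃ ≈ t) ∷ D →
      u₂ ≢ [] →
      NoneSelectedIn C P →
      NoneSelectedIn D Q →
      u₁ ++ u₂ ≻ s →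
      u₂ ++ u₃ ≻ t →
      E ∼ (u₁ ++ t ≈ s ++ u₃) ∷ C ++ D →
      Infer (P ∷ Q ∷ []) E

    rewriting : ∀ {P Q E} C D ⋈ u₁ u₂ u₃ s t →
      clause P ∼ lit ⋈ (u₁ ++ u₂ ++ u₃) s ∷ C →
      clause Q ∼ (u₂ ≈ t) ∷ D →
      (⋈ ≡ neg → IsSelectedIn (lit ⋈ (u₁ ++ u₂ ++ u₃) s) P) →
      (⋈ ≡ pos → NoneSelectedIn C P) →
      NoneSelectedIn D Q →
      u₂ ≻ t →
      E ∼ lit ⋈ (u₁ ++ t ++ u₃) s ∷ C ++ D →
      Infer (P ∷ Q ∷ []) E

    equalityResolution : ∀ {P E} C s →
      clause P ∼ (s ≉ s) ∷ C →
      IsSelectedIn (s ≉ s) P →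
      E ∼ C →
      Infer (P ∷ []) E

    paramodulation : ∀ {P Q E} C D u₁ u₂ u₃ s t →
      clause P ∼ (s ≈ u₁ ++ u₂) ∷ C →
      clause Q ∼ (u₂ ++ u₃ ≈ t) ∷ D →
      u₂ ≢ [] →
      NoneSelectedIn C P →
      Any Positive C →
      NoneSelectedIn D Q →
      s ≻ u₁ ++ u₂ →
      u₂ ++ u₃ ≻ t →
      E ∼ (s ++ u₃ ≈ u₁ ++ t) ∷ C ++ D →
      Infer (P ∷ Q ∷ []) E

    factoring : ∀ {P E} C s t u →
      clause P ∼ (s ≈ t) ∷ (s ++ u ≈ t ++ u) ∷ C →
      NoneSelectedIn C P →
      E ∼ (s ++ u ≈ t ++ u) ∷ C →
      Infer (P ∷ []) E

------------------------------------------------------------------------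
-- Strings and g-terms over the alphabet Fin k

Word : ℕ → Set
Word k = List (Fin k)

data GTerm (k : ℕ) : Set where
  ⊥ᵍ  : GTerm k
  _·_ : Fin k → GTerm k → GTerm k

infixr 6 _·_

-- The g-term w⊥.
_⊥ᵗ : ∀ {k} → Word k → GTerm k
w ⊥ᵗ = foldr _·_ ⊥ᵍ w

-- A g-term as a string over Σ ∪ {⊥}.
string : ∀ {k} → GTerm k → List (Fin k ₋)
string ⊥ᵍ      = ⊥₋ ∷ []
string (a · t) = [ a ] ∷ string t

-- A positive literal has one g-version for each w, a negative literal only one.
data GLiteral {k} : Literal (Word k) → Literal (GTerm k) → Set where
  positive : ∀ {s t} w → GLiteral (s ≈ t) ((s ++ w) ⊥ᵗ ≈ (t ++ w) ⊥ᵗ)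
  negative : ∀ {s t}   → GLiteral (s ≉ t) (s ⊥ᵗ ≉ t ⊥ᵗ)

GClause : ∀ {k} → Clause (Word k) → Clause (GTerm k) → Set
GClause = Pointwise GLiteral

record Selection (k : ℕ) : Set where
  field
    select          : Clause (Word k) → Maybe (Literal (Word k))
    select-cong     : ∀ {C D} → C ∼ D → Maybe.Pointwise _≃_ (select C) (select D)
    select-negative : ∀ {C L} → select C ≡ just L → Negative L × L ∈ᶜ C
    select-total    : ∀ {C} → Any Negative C → ∃[ L ] select C ≡ just L

ClauseSet : ℕ → Set₁
ClauseSet k = Pred (Clause (Word k)) 0ℓ

record ConditionalEquation {k} (C : Clause (Word k)) : Set where
  field
    conditions : List (Word k × Word k)
    l r        : Word k
    shape      : C ∼ map (λ (s , t) → s ≉ t) conditions ++ (l ≈ r) ∷ []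

record ConditionalEquationalTheory {k} (R : ClauseSet k) : Set where
  field
    -- membership depends only on the clause, not on its representation
    closed      : R Respects _∼_
    conditional : R ⊆ ConditionalEquation

------------------------------------------------------------------------
-- Semantics

record Interpretation (k : ℕ) : Set₁ where
  field
    _≡ᴵ_          : Rel (GTerm k) 0ℓ
    isEquivalence : IsEquivalence _≡ᴵ_
    cong          : ∀ a {p q} → p ≡ᴵ q → (a · p) ≡ᴵ (a · q)

module _ {k} (I : Interpretation k) where

  open Interpretation I

  True : Literal (GTerm k) → Set
  True (p ≈ q) = p ≡ᴵ q
  True (p ≉ q) = ¬ (p ≡ᴵ q)

  -- The disjunction is the classical one: since _≡ᴵ_ need not be decidable,
  -- without the double negation not even p ≉ q ∨ p ≈ q would be valid.
  SatisfiesG : Clause (GTerm k) → Set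
  SatisfiesG C = ¬ ¬ Any True C

  Satisfies : Clause (Word k) → Set
  Satisfies C = ∀ {C′} → GClause C C′ → SatisfiesG C′

infix 4 _⊨_ _⊨ᵍ_

_⊨_ : ∀ {k} → ClauseSet k → Literal (Word k) → Set₁
R ⊨ L = ∀ I → R ⊆ Satisfies I → Satisfies I (L ∷ [])

_⊨ᵍ_ : ∀ {k} → List (Clause (GTerm k)) → Clause (GTerm k) → Set₁
Cs ⊨ᵍ C = ∀ I → All (SatisfiesG I) Cs → SatisfiesG I C

------------------------------------------------------------------------
-- Redundancy and derivations

module Saturation {k} (_<_ : Rel (Fin k) 0ℓ) (sel : Selection k) where

  open Selection sel
  open Infimum _<_ using (_<₋_)

  private
    module Σ*  = Inference _<_
    module Σ*⊥ = Inference _<₋_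

  infix 4 _≻ᵍ_

  _≻ᵍ_ : Rel (GTerm k) 0ℓ
  p ≻ᵍ q = string p ≻ string q
    where open LengthLex _<₋_

  open ClauseOrder _≻ᵍ_ public

  Inf : List (Clause (Word k)) → Clause (Word k) → Set
  Inf Cs D = Σ*.Infer (map (λ C → premise C (select C)) Cs) D

  -- The g-versions of distinct negative literals are distinct, so the
  -- selected literal of a g-clause is determined by its value.
  record GPremise (C : Clause (Word k)) (P : Premise (GTerm k)) : Set where
    field
      isGClause : GClause C (clause P)
      inherited : Maybe.Pointwise GLiteral (select C) (selected P)

  record GInstance (Cs : List (Clause (Word k))) (D : Clause (Word k))
                   (Ps : List (Premise (GTerm k))) (D′ : Clause (GTerm k)) : Set where
    field
      premises   : Pointwise GPremise Cs Ps
      conclusion : GClause D D′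
      inference  : Σ*⊥.Infer (map (mapPremise string) Ps) (map (mapLiteral string) D′)

  MaximalPremise : Clause (GTerm k) → List (Premise (GTerm k)) → Set
  MaximalPremise C Ps = Any (λ P → C ≡ clause P) Ps × All (λ P → ¬ (clause P ≻ᶜ C)) Ps

  EntailedBelow : ClauseSet k → Clause (GTerm k) → Clause (GTerm k) → Set₁
  EntailedBelow S bound D =
    ∃[ Cs ] All (λ C′ → ∃[ C ] C ∈ S × GClause C C′) Cs
          × Cs ⊨ᵍ D
          × All (bound ≻ᶜ_) Cs

  RedundantG : ClauseSet k → Clause (GTerm k) → Set₁
  RedundantG S C = EntailedBelow S C C

  Redundant : ClauseSet k → Clause (Word k) → Set₁
  Redundant S C = ∀ {C′} → GClause C C′ → RedundantG S C′

  RedundantInference : ClauseSet k → List (Clause (Word k)) → Clause (Word k) → Set₁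
  RedundantInference S Cs D =
    ∀ {Ps D′ C′} → GInstance Cs D Ps D′ → MaximalPremise C′ Ps → EntailedBelow S C′ D′

  data Step (S S′ : ClauseSet k) : Set₁ where
    deduction : ∀ Cs C → All S Cs → Inf Cs C → S′ ≐ S ∪ (_∼ C) → Step S S′
    deletion  : ∀ D → Redundant S D → S′ ≐ S ∖ (_∼ D) → Step S S′

  -- A finite sequence S₀, …, Sₙ.
  Sequence : ℕ → Set₁
  Sequence n = Fin (ℕ.suc n) → ClauseSet k

  Derivation : ∀ {n} → Sequence n → Set₁
  Derivation {n} S = ∀ (i : Fin n) → Step (S (inject₁ i)) (S (suc i))

  limit : ∀ {n} → Sequence n → ClauseSet k
  limit {n} S = S (fromℕ n)

  union : ∀ {n} → Sequence n → ClauseSet k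
  union S C = ∃[ j ] C ∈ S j

  Fair : ∀ {n} → Sequence n → Set₁
  Fair S = ∀ Cs D → All (limit S) Cs → Inf Cs D → RedundantInference (union S) Cs D

FiniteClauseSet : ∀ {k} → ClauseSet k → Set
FiniteClauseSet S = ∃[ Cs ] S ≐ (λ C → Any (C ∼_) Cs)

-- The clauses of the limit that consist of a single equation, oriented by ≻,
-- form a string rewriting system.  Let nf be rightmost-innermost normalisation
-- that contracts each redex to its least contractum, and call two g-terms equal
-- when their normal forms coincide; this is a decidable congruence.  Every
-- clause of the derivation has exactly one positive literal, so a clause of the
-- limit is either a unit equation or has a selected literal.  By induction on
-- ≻ᶜ, using the redundancy of inferences as in the Bachmair-Ganzinger model
-- construction, the congruence satisfies every g-clause of the derivation:
-- a non-unit clause is handled by rewriting or resolving its selected literal,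
-- a unit equation by overlapping it with the rule that reduces its larger side.
-- Hence R ⊨ s ≈ t iff nf s ≡ nf t.

{-# OPTIONS --safe #-}
module Submission where

open import Data.Empty using (⊥-elim)
open import Data.Fin.Base using (Fin; zero; suc; inject₁; fromℕ)
open import Data.Fin.Induction using (<-weakInduction; >-weakInduction; spo-wellFounded)
import Data.Fin.Properties as Fin
open import Data.List.Base using (List; []; _∷_; _++_; filter; length; map)
open import Data.List.Membership.Propositional using () renaming (_∈_ to _∈ˡ_)
open import Data.List.Membership.Propositional.Properties using (∈-filter⁺; ∈-filter⁻)
open import Data.List.Properties
  using (length-++; ++-assoc; ++-identityʳ; ++-cancelˡ; ++-conicalˡ; ∷-injectiveˡ; ∷-injectiveʳ;
         ≡-dec)
open import Data.List.Relation.Binary.Lex.Strict as Lex using (Lex-<; base; this; next)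
import Data.List.Relation.Binary.Permutation.Homogeneous as ↭
import Data.List.Relation.Binary.Permutation.Setoid as Permutation
import Data.List.Relation.Binary.Permutation.Setoid.Properties as PermutationProperties
open import Data.List.Relation.Binary.Pointwise using (Pointwise; []; _∷_; Pointwise-≡⇒≡)
open import Data.List.Relation.Unary.All as All using (All; []; _∷_)
import Data.List.Relation.Unary.All.Properties as All
open import Data.List.Relation.Unary.Any using (Any; here; there)
import Data.List.Relation.Unary.Any.Properties as Any
open import Data.Maybe.Base using (Maybe; just; nothing)
import Data.Maybe.Relation.Binary.Pointwise as Maybe using (Pointwise; just; nothing)
import Data.Maybe.Relation.Unary.All as Maybe using (just; nothing)
import Data.Maybe.Relation.Unary.Any as Maybe using (Any; just)
open import Data.Nat.Base as ℕ using (ℕ; zero; suc; _+_; s≤s)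
open import Data.Nat.Induction using (<-wellFounded)
import Data.Nat.Properties as ℕ
open import Data.Product.Base using (∃-syntax; _×_; _,_; proj₁; proj₂)
open import Data.Sum.Base using (_⊎_; inj₁; inj₂)
open import Function.Base as F using (_∘_)
open import Induction.WellFounded using (Acc; acc; WellFounded; module Subrelation)
open import Level using (0ℓ)
open import Relation.Binary.Bundles using (Setoid)
import Relation.Binary.Construct.Add.Infimum.Strict as Infimum
open import Relation.Binary.Construct.Closure.Transitive as Plus using (TransClosure)
import Relation.Binary.Construct.On as On
open import Relation.Binary.Core using (Rel)
open import Relation.Binary.Definitions
  using (_Respects_; _Respectsˡ_; Decidable; Transitive; tri<; tri≈; tri>)
open import Relation.Binary.PropositionalEquality
  using (_≡_; _≢_; refl; sym; trans; cong; cong₂; subst; subst₂; setoid; isEquivalence)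
open import Relation.Binary.Structures using (IsEquivalence; IsStrictTotalOrder)
open import Relation.Nullary.Construct.Add.Infimum using ([_])
open import Relation.Nullary.Decidable.Core using (Dec; yes; no; map′; decidable-stable)
open import Relation.Nullary.Negation.Core using (¬_; contradiction)
open import Relation.Unary using (_∈_; _⊆_; _≐_)
open import Defs
open Inference

-- Well-foundedness of the multiset extension

module MultisetOrder (S : Setoid 0ℓ 0ℓ) (_≻_ : Rel (Setoid.Carrier S) 0ℓ)
                     (≻-respˡ : _≻_ Respectsˡ (Setoid._≈_ S)) where

  open Setoid S using () renaming (Carrier to A; _≈_ to _≈ˢ_; sym to ≈-sym)
  open Permutation S
  open PermutationProperties S using (↭-split; ++⁺ˡ; ++⁺ʳ; shifts; ↭-shift)
  open MultisetExtension S _≻_ public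

  ≻ᵐ-respˡ : _≻ᵐ_ Respectsˡ _↭_
  ≻ᵐ-respˡ M↭N M≻ = record { _≻ᵐ_ M≻ ; M-split = ↭-trans (↭-sym M↭N) (_≻ᵐ_.M-split M≻) }

  -- One step of the multiset ordering, in which a single element gives way to finitely many smaller
  -- ones. Accessibility is proved for this relation and carried over to `_≻ᵐ_` through the
  -- transitive closure.
  data _⋖_ (N M : List A) : Set where
    replace : ∀ x ys K → M ↭ x ∷ K → N ↭ ys ++ K → All (x ≻_) ys → N ⋖ M

  Acc-⋖-resp : ∀ {M N} → M ↭ N → Acc _⋖_ M → Acc _⋖_ N
  Acc-⋖-resp M↭N (acc rs) = acc λ where
    (replace x ys K N↭ N′↭ x≻ys) → rs (replace x ys K (↭-trans M↭N N↭) N′↭ x≻ys)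

  -- Locating `z` in `x ∷ M` leaves two cases: it is the head, or it lies in `M`, and then the two
  -- tails share a remainder `K′`.
  ∷-↭-∷ : ∀ {x z M K} → x ∷ M ↭ z ∷ K →
          (x ≈ˢ z × M ↭ K) ⊎ ∃[ K′ ] M ↭ z ∷ K′ × K ↭ x ∷ K′
  ∷-↭-∷ {z = z} {K = K} p with ↭-split z [] K p
  ... | []     , qs , x≈z ∷ M≋qs , qs↭K = inj₁ (x≈z , ↭-transˡ-≋ M≋qs qs↭K)
  ... | y ∷ ps , qs , x≈y ∷ M≋ , ps++qs↭K =
    inj₂ ( ps ++ qs , ↭-trans (↭-reflexive-≋ M≋) (↭-shift ps qs)
         , ↭-trans (↭-sym ps++qs↭K) (prep (≈-sym x≈y) ↭-refl))

  Acc-⋖-++ : ∀ {ys} → All (λ y → ∀ {K} → Acc _⋖_ K → Acc _⋖_ (y ∷ K)) ys →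
             ∀ {K} → Acc _⋖_ K → Acc _⋖_ (ys ++ K)
  Acc-⋖-++ []       a = a
  Acc-⋖-++ (p ∷ ps) a = p (Acc-⋖-++ ps a)

  -- Nested induction, on `x` outside and on `M` inside. A step that replaces `x` inserts smaller
  -- elements, which the outer hypothesis adds one at a time; a step inside `M` falls under the
  -- inner hypothesis.
  Acc-⋖-∷ : ∀ {x} → Acc (F.flip _≻_) x → ∀ {M} → Acc _⋖_ M → Acc _⋖_ (x ∷ M)
  Acc-⋖-∷-step : ∀ {x} → Acc (F.flip _≻_) x → ∀ {M} → Acc _⋖_ M →
                 ∀ {N} → N ⋖ (x ∷ M) → Acc _⋖_ N

  Acc-⋖-∷ aˣ aᴹ = acc (Acc-⋖-∷-step aˣ aᴹ)

  Acc-⋖-∷-step aˣ aᴹ (replace z ys K xM↭ N↭ z≻ys) with ∷-↭-∷ xM↭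
  Acc-⋖-∷-step (acc rs) aᴹ (replace z ys K _ N↭ z≻ys) | inj₁ (x≈z , M↭K) =
    Acc-⋖-resp (↭-sym N↭) (Acc-⋖-++ (All.map smaller z≻ys) (Acc-⋖-resp M↭K aᴹ))
    where
    smaller : ∀ {y} → z ≻ y → ∀ {K} → Acc _⋖_ K → Acc _⋖_ (y ∷ K)
    smaller z≻y = Acc-⋖-∷ (rs (≻-respˡ (≈-sym x≈z) z≻y))
  Acc-⋖-∷-step aˣ (acc rs) (replace z ys K _ N↭ z≻ys) | inj₂ (K′ , M↭ , K↭) =
    Acc-⋖-resp (↭-sym (↭-trans N↭ (↭-trans (++⁺ˡ ys K↭) (↭-shift ys K′))))
               (Acc-⋖-∷ aˣ (rs (replace z ys K′ M↭ ↭-refl z≻ys)))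

  ⋖-wellFounded : WellFounded (F.flip _≻_) → WellFounded _⋖_
  ⋖-wellFounded wf []      = acc λ where
    (replace x _ _ []↭ _ _) → ⊥-elim (PermutationProperties.¬x∷xs↭[] S (↭-sym []↭))
  ⋖-wellFounded wf (x ∷ M) = Acc-⋖-∷ (wf x) (⋖-wellFounded wf M)

  -- Separates the added elements charged to `x` from those charged to `xs`, so that `x` can be
  -- exchanged alone.
  partition-dominated : ∀ {x xs} ys → All (λ y → Any (_≻ y) (x ∷ xs)) ys →
    ∃[ us ] ∃[ vs ] ys ↭ us ++ vs × All (x ≻_) us × All (λ y → Any (_≻ y) xs) vs
  partition-dominated []       []       = [] , [] , ↭-refl , [] , []
  partition-dominated (y ∷ ys) (p ∷ ps) with p | partition-dominated ys ps
  ... | here x≻y   | us , vs , e , x≻us , d =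
    y ∷ us , vs , ↭-prep y e , x≻y ∷ x≻us , d
  ... | there xs≻y | us , vs , e , x≻us , d =
    us , y ∷ vs , ↭-trans (↭-prep y e) (↭-sym (↭-shift us vs)) , x≻us , xs≻y ∷ d

  -- The removed elements are replaced one at a time, each by the added
  -- elements that it dominates; transitivity of ≻ is not needed.
  ≻ᵐ⇒⋖⁺ : ∀ {M N} K x xs ys → M ↭ K ++ x ∷ xs → N ↭ K ++ ys →
          All (λ y → Any (_≻ y) (x ∷ xs)) ys → TransClosure _⋖_ N M
  ≻ᵐ⇒⋖⁺ K x xs ys M↭ N↭ d with partition-dominated ys d
  ... | us , vs , ys↭ , x≻us , d′ = go xs M↭ d′
    where
    N↭′ : _ ↭ (us ++ K) ++ vs
    N↭′ = ↭-trans N↭ (↭-trans (++⁺ˡ K ys↭)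
            (↭-trans (shifts K us) (↭-reflexive (sym (++-assoc us K vs)))))
    go : ∀ xs → _ ↭ K ++ x ∷ xs → All (λ y → Any (_≻ y) xs) vs → TransClosure _⋖_ _ _
    go [] M↭ [] = Plus.[ replace x us K
      (↭-trans M↭ (↭-trans (↭-shift K []) (↭-prep x (↭-reflexive (++-identityʳ K)))))
      (↭-trans N↭′ (↭-reflexive (++-identityʳ _))) x≻us ]
    go (x′ ∷ xs) M↭ d = Plus._∷ʳ_
      (≻ᵐ⇒⋖⁺ (us ++ K) x′ xs vs ↭-refl N↭′ d)
      (replace x us (K ++ x′ ∷ xs) (↭-trans M↭ (↭-shift K _)) (↭-reflexive (++-assoc us K _)) x≻us)

  ≻ᵐ-wellFounded : WellFounded (F.flip _≻_) → WellFounded (F.flip _≻ᵐ_)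
  ≻ᵐ-wellFounded wf =
    Subrelation.wellFounded ≻ᵐ⇒⁺ (Plus.wellFounded _⋖_ (⋖-wellFounded wf))
    where
    ≻ᵐ⇒⁺ : ∀ {N M} → M ≻ᵐ N → TransClosure _⋖_ N M
    ≻ᵐ⇒⁺ record { removed = [] ; removed-nonempty = ne } = ⊥-elim (ne refl)
    ≻ᵐ⇒⁺ record { kept = K ; removed = x ∷ xs ; added = ys
                ; M-split = M↭ ; N-split = N↭ ; dominated = d } = ≻ᵐ⇒⋖⁺ K x xs ys M↭ N↭ d

-- The length-lexicographic ordering

wf⇒irrefl : ∀ {A : Set} {_<_ : Rel A 0ℓ} → WellFounded _<_ → ∀ {x} → ¬ (x < x)
wf⇒irrefl {_<_ = _<_} wf {x} = go (wf x)
  where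
  go : ∀ {x} → Acc _<_ x → ¬ (x < x)
  go (acc rs) x<x = go (rs x<x) x<x

wf⇒asym : ∀ {A : Set} {_<_ : Rel A 0ℓ} → WellFounded _<_ → ∀ {x y} → x < y → ¬ (y < x)
wf⇒asym {_<_ = _<_} wf {x} = go (wf x)
  where
  go : ∀ {x y} → Acc _<_ x → x < y → ¬ (y < x)
  go (acc rs) x<y y<x = go (rs y<x) y<x x<y

-- Levi's lemma. It later decides where a redex begins and ends relative to the left-hand side of a
-- rule.
++-split : ∀ {A : Set} (as : List A) {bs} cs {ds} → as ++ bs ≡ cs ++ ds →
           (∃[ es ] as ≡ cs ++ es × ds ≡ es ++ bs) ⊎ (∃[ es ] cs ≡ as ++ es × bs ≡ es ++ ds)
++-split as []       eq = inj₁ (as , refl , sym eq)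
++-split [] (c ∷ cs) eq = inj₂ (c ∷ cs , refl , eq)
++-split (a ∷ as) (c ∷ cs) eq with refl ← ∷-injectiveˡ eq | ++-split as cs (∷-injectiveʳ eq)
... | inj₁ (es , p , q) = inj₁ (es , cong (a ∷_) p , q)
... | inj₂ (es , p , q) = inj₂ (es , cong (a ∷_) p , q)

toWord : ∀ {k} → GTerm k → Word k
toWord ⊥ᵍ      = []
toWord (a · p) = a ∷ toWord p

toWord-⊥ᵗ : ∀ {k} (w : Word k) → toWord (w ⊥ᵗ) ≡ w
toWord-⊥ᵗ []      = refl
toWord-⊥ᵗ (a ∷ w) = cong (a ∷_) (toWord-⊥ᵗ w)

length-string : ∀ {k} (p : GTerm k) → length (string p) ≡ suc (length (toWord p))
length-string ⊥ᵍ      = refl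
length-string (a · p) = cong suc (length-string p)

string-++ : ∀ {k} (u : Word k) {w} → string ((u ++ w) ⊥ᵗ) ≡ map [_] u ++ string (w ⊥ᵗ)
string-++ []      = refl
string-++ (a ∷ u) = cong ([ a ] ∷_) (string-++ u)

module WordOrder {k} (_<_ : Rel (Fin k) 0ℓ) (<-isSTO : IsStrictTotalOrder _≡_ _<_) where

  open IsStrictTotalOrder <-isSTO using (isStrictPartialOrder; <-resp-≈)
    renaming (trans to <-trans; compare to <-compare)
  open Infimum _<_ using (_<₋_; [_])
  open LengthLex _<_ public

  private
    module ≻ᵍ = LengthLex _<₋_

  ≻-trans : Transitive _≻_
  ≻-trans (inj₁ p)       (inj₁ q)        = inj₁ (ℕ.<-trans q p)
  ≻-trans (inj₁ p)       (inj₂ (e , _))  = inj₁ (subst (ℕ._< _) e p)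
  ≻-trans (inj₂ (e , _)) (inj₁ q)        = inj₁ (subst (_ ℕ.<_) (sym e) q)
  ≻-trans (inj₂ (e , p)) (inj₂ (e′ , q)) =
    inj₂ (trans e e′ , Lex.<-transitive isEquivalence <-resp-≈ <-trans q p)

  ≻-total : ∀ s t → s ≡ t ⊎ s ≻ t ⊎ t ≻ s
  ≻-total s t with ℕ.<-cmp (length s) (length t)
  ... | tri< lt _ _ = inj₂ (inj₂ (inj₁ lt))
  ... | tri> _ _ gt = inj₂ (inj₁ (inj₁ gt))
  ... | tri≈ _ e _ with Lex.<-compare sym <-compare s t
  ...   | tri< lt _ _ = inj₂ (inj₂ (inj₂ (sym e , lt)))
  ...   | tri≈ _ eq _ = inj₁ (Pointwise-≡⇒≡ eq)
  ...   | tri> _ _ gt = inj₂ (inj₁ (inj₂ (e , gt)))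

  private
    _≺ˡ_ : Rel (Word k) 0ℓ
    t ≺ˡ s = length s ≡ length t × Lex-< _≡_ _<_ t s

    -- The lexicographic order need not be well-founded on all words, but it is on words of a fixed
    -- length `n`. When the head decreases, the new tail is arbitrary, so its accessibility comes
    -- from the induction on length.
    ≺ˡ-acc : ∀ n {s} → length s ≡ n → Acc _≺ˡ_ s
    ∷-≺ˡ-acc : ∀ n {a s} → Acc _<_ a → Acc _≺ˡ_ s → length s ≡ n → Acc _≺ˡ_ (a ∷ s)
    ∷-≺ˡ-acc-step : ∀ n {a s t} → Acc _<_ a → Acc _≺ˡ_ s → length s ≡ n →
                    t ≺ˡ (a ∷ s) → Acc _≺ˡ_ t

    ≺ˡ-acc zero    {[]}    _ = acc λ where (_ , base ())
    ≺ˡ-acc (suc n) {a ∷ s} e =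
      ∷-≺ˡ-acc n (spo-wellFounded isStrictPartialOrder a) (≺ˡ-acc n e′) e′
      where e′ = ℕ.suc-injective e

    ∷-≺ˡ-acc n aᵃ aˢ e = acc (∷-≺ˡ-acc-step n aᵃ aˢ e)

    ∷-≺ˡ-acc-step n (acc rs) _ e (e′ , this b<a) =
      let e″ = trans (sym (ℕ.suc-injective e′)) e in ∷-≺ˡ-acc n (rs b<a) (≺ˡ-acc n e″) e″
    ∷-≺ˡ-acc-step n aᵃ (acc rs) e (e′ , next refl t<s) =
      let e″ = ℕ.suc-injective e′ in ∷-≺ˡ-acc n aᵃ (rs (e″ , t<s)) (trans (sym e″) e)

    -- Outer induction on the length, inner induction on the lexicographic order; a shorter word
    -- starts afresh with `≺ˡ-acc`.
    ≻-acc : ∀ n {s} → Acc ℕ._<_ n → length s ≡ n → Acc _≺ˡ_ s → Acc (F.flip _≻_) s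
    ≻-acc-step : ∀ n {s t} → Acc ℕ._<_ n → length s ≡ n → Acc _≺ˡ_ s → s ≻ t → Acc (F.flip _≻_) t

    ≻-acc n aⁿ e aˢ = acc (≻-acc-step n aⁿ e aˢ)

    ≻-acc-step n (acc rs) e _ (inj₁ lt) = ≻-acc _ (rs (subst (_ ℕ.<_) e lt)) refl (≺ˡ-acc _ refl)
    ≻-acc-step n aⁿ e (acc rs) (inj₂ (e′ , l)) = ≻-acc n aⁿ (trans (sym e′) e) (rs (e′ , l))

  ≻-wellFounded : WellFounded (F.flip _≻_)
  ≻-wellFounded s = ≻-acc _ (<-wellFounded (length s)) refl (≺ˡ-acc _ refl)

  ≻-irrefl : ∀ {s} → ¬ (s ≻ s)
  ≻-irrefl = wf⇒irrefl ≻-wellFounded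

  _≻?_ : Decidable _≻_
  s ≻? t with ≻-total s t
  ... | inj₂ (inj₁ s≻t) = yes s≻t
  ... | inj₁ refl       = no ≻-irrefl
  ... | inj₂ (inj₂ t≻s) = no λ s≻t → ≻-irrefl (≻-trans s≻t t≻s)

  ≻-++ʳ : ∀ {s t} w → s ≻ t → s ++ w ≻ t ++ w
  ≻-++ʳ {s} {t} w = λ where
      (inj₁ lt) → inj₁ (subst₂ ℕ._<_ (sym (length-++ t)) (sym (length-++ s)) (ℕ.+-monoˡ-< _ lt))
      (inj₂ (e , l)) → inj₂
        (trans (length-++ s) (trans (cong (ℕ._+ length w) e) (sym (length-++ t))) , lex e l)
    where
    lex : ∀ {s t} → length s ≡ length t → Lex-< _≡_ _<_ t s → Lex-< _≡_ _<_ (t ++ w) (s ++ w)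
    lex e (base ())
    lex e (this a<b)    = this a<b
    lex e (next refl l) = next refl (lex (ℕ.suc-injective e) l)

  ≻-++ˡ : ∀ {s t} u → s ≻ t → u ++ s ≻ u ++ t
  ≻-++ˡ []      p = p
  ≻-++ˡ (a ∷ u) p with ≻-++ˡ u p
  ... | inj₁ lt      = inj₁ (s≤s lt)
  ... | inj₂ (e , l) = inj₂ (cong suc e , next refl l)

  ++-≻ : ∀ a u x → (a ∷ u) ++ x ≻ x
  ++-≻ a u x = inj₁ (s≤s (subst (length x ℕ.≤_) (sym (length-++ u)) (ℕ.m≤n+m _ _)))

  ≻⇒≢[] : ∀ {s t} → s ≻ t → s ≢ []
  ≻⇒≢[] (inj₁ ()) refl
  ≻⇒≢[] (inj₂ (_ , base ())) refl

  ⊥ᵗ-≻ : ∀ {s t} → s ≻ t → string (s ⊥ᵗ) ≻ᵍ.≻ string (t ⊥ᵗ)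
  ⊥ᵗ-≻ {s} {t} = λ where
      (inj₁ lt)      → inj₁ (subst₂ ℕ._<_ (sym (len t)) (sym (len s)) (s≤s lt))
      (inj₂ (e , l)) → inj₂ (trans (len s) (trans (cong suc e) (sym (len t))) , lex e l)
    where
    len : ∀ s → length (string (s ⊥ᵗ)) ≡ suc (length s)
    len s = trans (length-string (s ⊥ᵗ)) (cong (λ s → suc (length s)) (toWord-⊥ᵗ s))
    lex : ∀ {s t} → length s ≡ length t → Lex-< _≡_ _<_ t s →
          Lex-< _≡_ _<₋_ (string (t ⊥ᵗ)) (string (s ⊥ᵗ))
    lex e (base ())
    lex e (this a<b)    = this [ a<b ]
    lex e (next refl l) = next refl (lex (ℕ.suc-injective e) l)

  -- The final `⊥` adds one to both lengths. For equal lengths it sits at the same position in both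
  -- strings, so it is never compared with a letter.
  ≻ᵍ⇒≻ : ∀ p q → string p ≻ᵍ.≻ string q → toWord p ≻ toWord q
  ≻ᵍ⇒≻ p q (inj₁ lt) = inj₁ (ℕ.s≤s⁻¹ (subst₂ ℕ._<_ (length-string q) (length-string p) lt))
  ≻ᵍ⇒≻ p q (inj₂ (e , l)) =
    inj₂ (ℕ.suc-injective (trans (sym (length-string p)) (trans e (length-string q))) , lex p q e l)
    where
    lex : ∀ p q → length (string p) ≡ length (string q) → Lex-< _≡_ _<₋_ (string q) (string p) →
          Lex-< _≡_ _<_ (toWord q) (toWord p)
    lex ⊥ᵍ ⊥ᵍ e (this ())
    lex ⊥ᵍ ⊥ᵍ e (next _ (base ()))
    lex ⊥ᵍ (_ · q) e l with () ← trans (ℕ.suc-injective e) (length-string q)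
    lex (_ · p) ⊥ᵍ e l with () ← trans (sym (ℕ.suc-injective e)) (length-string p)
    lex (a · p) (b · q) e (this [ a<b ])  = this a<b
    lex (a · p) (a · q) e (next refl l) = next refl (lex p q (ℕ.suc-injective e) l)

  ≻ᵍ-wellFounded : WellFounded (λ q p → string p ≻ᵍ.≻ string q)
  ≻ᵍ-wellFounded p = go (≻-wellFounded (toWord p))
    where
    go : ∀ {p} → Acc (F.flip _≻_) (toWord p) → Acc (λ q p → string p ≻ᵍ.≻ string q) p
    go (acc rs) = acc λ p≻q → go (rs (≻ᵍ⇒≻ _ _ p≻q))

-- Normal forms

Rule : ℕ → Set
Rule k = Word k × Word k

-- Contraction at the root of a g-term: the left-hand side is a prefix, and the suffix `w`
-- instantiates the variable implicit in a positive literal.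
data Contraction {k} (ρs : List (Rule k)) (x y : Word k) : Set where
  contract : ∀ l r w → (l , r) ∈ˡ ρs → x ≡ l ++ w → y ≡ r ++ w → Contraction ρs x y

prefix? : ∀ {k} (l x : Word k) → (∃[ w ] x ≡ l ++ w) ⊎ (∀ w → x ≢ l ++ w)
prefix? []      x       = inj₁ (x , refl)
prefix? (a ∷ l) []      = inj₂ λ _ ()
prefix? (a ∷ l) (b ∷ x) with a Fin.≟ b | prefix? l x
... | yes refl | inj₁ (w , refl) = inj₁ (w , refl)
... | yes refl | inj₂ ¬p         = inj₂ λ w eq → ¬p w (∷-injectiveʳ eq)
... | no a≢b   | _               = inj₂ λ w eq → a≢b (sym (∷-injectiveˡ eq))

contracta : ∀ {k} → List (Rule k) → Word k → List (Word k)
contracta []             x = []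
contracta ((l , r) ∷ ρs) x with prefix? l x
... | inj₁ (w , _) = (r ++ w) ∷ contracta ρs x
... | inj₂ _       = contracta ρs x

contracta-sound : ∀ {k} (ρs : List (Rule k)) {x y} → y ∈ˡ contracta ρs x → Contraction ρs x y
contracta-sound ((l , r) ∷ ρs) {x} p with prefix? l x
contracta-sound ((l , r) ∷ ρs) (here y≡) | inj₁ (w , x≡) = contract l r w (here refl) x≡ y≡
contracta-sound ((l , r) ∷ ρs) (there p) | inj₁ _ with contracta-sound ρs p
... | contract l′ r′ w′ q x≡ y≡ = contract l′ r′ w′ (there q) x≡ y≡
contracta-sound ((l , r) ∷ ρs) p         | inj₂ _ with contracta-sound ρs p
... | contract l′ r′ w′ q x≡ y≡ = contract l′ r′ w′ (there q) x≡ y≡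

contracta-complete : ∀ {k} (ρs : List (Rule k)) {x y} → Contraction ρs x y → y ∈ˡ contracta ρs x
contracta-complete ((l , r) ∷ ρs) {x} (contract _ _ w p x≡ y≡) with prefix? l x
contracta-complete ((l , r) ∷ ρs) (contract _ _ w (here refl) x≡ y≡) | inj₁ (v , x≡′) =
  here (trans y≡ (cong (r ++_) (++-cancelˡ l w v (trans (sym x≡) x≡′))))
contracta-complete ((l , r) ∷ ρs) (contract _ _ w (here refl) x≡ y≡) | inj₂ ¬p =
  contradiction x≡ (¬p w)
contracta-complete ((l , r) ∷ ρs) (contract l′ r′ w (there p) x≡ y≡) | inj₁ _ =
  there (contracta-complete ρs (contract l′ r′ w p x≡ y≡))
contracta-complete ((l , r) ∷ ρs) (contract l′ r′ w (there p) x≡ y≡) | inj₂ _ =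
  contracta-complete ρs (contract l′ r′ w p x≡ y≡)

module Normalisation {k} (_<_ : Rel (Fin k) 0ℓ) (<-isSTO : IsStrictTotalOrder _≡_ _<_)
  (ρs : List (Rule k)) (decreasing : ∀ {l r} → (l , r) ∈ˡ ρs → LengthLex._≻_ _<_ l r) where

  open WordOrder _<_ <-isSTO

  least : List (Word k) → Maybe (Word k)
  least []       = nothing
  least (y ∷ ys) with least ys
  ... | nothing = just y
  ... | just m  with ≻-total y m
  ...   | inj₂ (inj₁ _) = just m
  ...   | _             = just y

  least-nothing : ∀ ys → least ys ≡ nothing → ys ≡ []
  least-nothing []       _ = refl
  least-nothing (y ∷ ys) eq with least ys
  ... | just m with ≻-total y m
  least-nothing (y ∷ ys) () | just m | inj₁ _
  least-nothing (y ∷ ys) () | just m | inj₂ (inj₁ _)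
  least-nothing (y ∷ ys) () | just m | inj₂ (inj₂ _)

  least-just : ∀ ys {m} → least ys ≡ just m →
               m ∈ˡ ys × (∀ {z} → z ∈ˡ ys → z ≡ m ⊎ z ≻ m)
  least-just (y ∷ ys) eq with least ys in eq′
  least-just (y ∷ ys) refl | nothing with refl ← least-nothing ys eq′ =
    here refl , λ where (here refl) → inj₁ refl
  least-just (y ∷ ys) eq | just m with ≻-total y m | least-just ys eq′
  least-just (y ∷ ys) refl | just m | inj₁ refl | m∈ , min =
    here refl , λ where
      (here refl) → inj₁ refl
      (there z∈)  → min z∈
  least-just (y ∷ ys) refl | just m | inj₂ (inj₁ y≻m) | m∈ , min =
    there m∈ , λ where
      (here refl) → inj₂ y≻m
      (there z∈)  → min z∈
  least-just (y ∷ ys) refl | just m | inj₂ (inj₂ m≻y) | m∈ , min =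
    here refl , λ where
      (here refl) → inj₁ refl
      (there z∈)  → inj₂ (below (min z∈))
    where
    below : ∀ {z} → z ≡ m ⊎ z ≻ m → z ≻ y
    below (inj₁ refl) = m≻y
    below (inj₂ z≻m)  = ≻-trans z≻m m≻y

  root : Word k → Maybe (Word k)
  root x = least (contracta ρs x)

  -- The tail is searched before the root, so a step of `p` stays a step of `a ∷ p`. Equality of
  -- normal forms is therefore a congruence without any appeal to confluence.
  step : Word k → Maybe (Word k)
  step []      = nothing
  step (a ∷ p) with step p
  ... | just q  = just (a ∷ q)
  ... | nothing = root (a ∷ p)

  -- The contracted position is recorded as a suffix `x` on which `step` and `root` agree, so the
  -- contraction is also the first reduction step of `x` on its own.
  step-just : ∀ p {q} → step p ≡ just q →
              ∃[ u ] ∃[ x ] ∃[ y ] p ≡ u ++ x × q ≡ u ++ y × step x ≡ just y × root x ≡ just y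
  step-just (a ∷ p) eq with step p in eq′
  step-just (a ∷ p) refl | just q with step-just p eq′
  ... | u , x , y , p≡ , q≡ , s , r = a ∷ u , x , y , cong (a ∷_) p≡ , cong (a ∷_) q≡ , s , r
  step-just (a ∷ p) {q} eq | nothing = [] , a ∷ p , q , refl , refl , helper , eq
    where
    helper : step (a ∷ p) ≡ just q
    helper rewrite eq′ = eq

  contraction-≻ : ∀ {x y} → Contraction ρs x y → x ≻ y
  contraction-≻ (contract l r w p refl refl) = ≻-++ʳ w (decreasing p)

  step-≻ : ∀ p {q} → step p ≡ just q → p ≻ q
  step-≻ p eq with step-just p eq
  ... | u , x , y , refl , refl , _ , r =
    ≻-++ˡ u (contraction-≻ (contracta-sound ρs (proj₁ (least-just _ r))))

  redex-reducible : ∀ {x y} → Contraction ρs x y → step x ≢ nothing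
  redex-reducible {[]} (contract l r w p []≡ _) _ = ≻⇒≢[] (decreasing p) (++-conicalˡ l w (sym []≡))
  redex-reducible {a ∷ x} c eq with step x
  ... | nothing with () ← subst (_ ∈ˡ_) (least-nothing _ eq) (contracta-complete ρs c)

  data _⇓_ : Rel (Word k) 0ℓ where
    stop : ∀ {p} → step p ≡ nothing → p ⇓ p
    go   : ∀ {p q n} → step p ≡ just q → q ⇓ n → p ⇓ n

  ⇓-deterministic : ∀ {p m n} → p ⇓ m → p ⇓ n → m ≡ n
  ⇓-deterministic (stop _)  (stop _)  = refl
  ⇓-deterministic (stop e)  (go e′ _) with () ← trans (sym e) e′
  ⇓-deterministic (go e _)  (stop e′) with () ← trans (sym e) e′
  ⇓-deterministic (go e p⇓) (go e′ q⇓) with refl ← trans (sym e) e′ = ⇓-deterministic p⇓ q⇓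

  normalise : ∀ p → Acc (F.flip _≻_) p → ∃[ n ] p ⇓ n
  normalise p (acc rs) with step p in eq
  ... | nothing = p , stop eq
  ... | just q with normalise q (rs (step-≻ p eq))
  ...   | n , q⇓n = n , go eq q⇓n

  abstract
    nf : Word k → Word k
    nf p = proj₁ (normalise p (≻-wellFounded p))

    nf-⇓ : ∀ p → p ⇓ nf p
    nf-⇓ p = proj₂ (normalise p (≻-wellFounded p))

  ⇓⇒nf : ∀ {p n} → p ⇓ n → nf p ≡ n
  ⇓⇒nf = ⇓-deterministic (nf-⇓ _)

  step-nothing⇒nf : ∀ {p} → step p ≡ nothing → nf p ≡ p
  step-nothing⇒nf eq = ⇓⇒nf (stop eq)

  step-just⇒nf : ∀ {p q} → step p ≡ just q → nf p ≡ nf q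
  step-just⇒nf eq = ⇓⇒nf (go eq (nf-⇓ _))

  nf-∷-⇓ : ∀ a {p n} → p ⇓ n → nf (a ∷ p) ≡ nf (a ∷ n)
  nf-∷-⇓ a (stop _) = refl
  nf-∷-⇓ a {p} (go {q = q} eq q⇓n) = trans (step-just⇒nf step-∷) (nf-∷-⇓ a q⇓n)
    where
    step-∷ : step (a ∷ p) ≡ just (a ∷ q)
    step-∷ rewrite eq = refl

  nf-∷ : ∀ a {p q} → nf p ≡ nf q → nf (a ∷ p) ≡ nf (a ∷ q)
  nf-∷ a {p} {q} eq =
    trans (nf-∷-⇓ a (nf-⇓ p)) (trans (cong (λ n → nf (a ∷ n)) eq) (sym (nf-∷-⇓ a (nf-⇓ q))))

  nf-++ : ∀ u {p q} → nf p ≡ nf q → nf (u ++ p) ≡ nf (u ++ q)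
  nf-++ []      eq = eq
  nf-++ (a ∷ u) eq = nf-∷ a (nf-++ u eq)

  -- The contractum being the least one is what makes the second premise of
  -- an overlap at the root no larger than the first.
  record LeastRedex (l w r : Word k) : Set where
    field
      rule  : (l , r) ∈ˡ ρs
      equal : nf (l ++ w) ≡ nf (r ++ w)
      least-contractum : ∀ {z} → Contraction ρs (l ++ w) z → z ≡ r ++ w ⊎ z ≻ r ++ w

  data Reducible (p : Word k) : Set where
    reducible : ∀ u l w r → p ≡ u ++ l ++ w → LeastRedex l w r → Reducible p

  step-just⇒Reducible : ∀ {p q} → step p ≡ just q → Reducible p
  step-just⇒Reducible {p} eq with step-just p eq
  ... | u , x , y , refl , refl , step≡ , root≡ with least-just _ root≡
  ... | y∈ , least with contracta-sound ρs y∈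
  ... | contract l r w rule refl refl = reducible u l w r refl record
    { rule = rule ; equal = step-just⇒nf step≡
    ; least-contractum = λ c → least (contracta-complete ρs c) }

  normal⊎reducible : ∀ p → nf p ≡ p ⊎ Reducible p
  normal⊎reducible p with step p in eq
  ... | nothing = inj₁ (step-nothing⇒nf eq)
  ... | just q  = inj₂ (step-just⇒Reducible eq)

  -- The given contraction only guarantees that reduction does not stop at `x`; the redex actually
  -- chosen may lie deeper or belong to another rule.
  redex⇒Reducible : ∀ {x y} → Contraction ρs x y → Reducible x
  redex⇒Reducible {x} c with step x in eq
  ... | nothing = contradiction eq (redex-reducible c)
  ... | just q  = step-just⇒Reducible eq

-- Soundness of the inference rules

module ∼ {T : Set} where
  open Permutation (literalSetoid T) public hiding (_↭_)
  open PermutationProperties (literalSetoid T) public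
    using (Any-resp-↭; ∈-resp-↭; xs↭ys⇒|xs|≡|ys|; map⁺)

≃-sym : ∀ {T} {K L : Literal T} → K ≃ L → L ≃ K
≃-sym = IsEquivalence.sym ≃-isEquivalence

GLiteral-≃ : ∀ {k} {K L : Literal (Word k)} {K′} → K ≃ L → GLiteral K K′ →
             ∃[ L′ ] GLiteral L L′ × K′ ≃ L′
GLiteral-≃ same g            = _ , g , same
GLiteral-≃ flip (positive w) = _ , positive w , flip
GLiteral-≃ flip negative     = _ , negative , flip

GClause-∼ : ∀ {k} {C D : Clause (Word k)} {C′} → C ∼ D → GClause C C′ →
            ∃[ D′ ] GClause D D′ × C′ ∼ D′
GClause-∼ (↭.refl C≋D) gs =
  let _ , gs′ , C′≋D′ = pointwise C≋D gs in _ , gs′ , ↭.refl C′≋D′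
  where
  pointwise : ∀ {C D C′} → Pointwise _≃_ C D → GClause C C′ →
              ∃[ D′ ] GClause D D′ × Pointwise _≃_ C′ D′
  pointwise []       []       = _ , [] , []
  pointwise (e ∷ es) (g ∷ gs) =
    let _ , g′ , e′ = GLiteral-≃ e g ; _ , gs′ , es′ = pointwise es gs
    in _ , g′ ∷ gs′ , e′ ∷ es′
GClause-∼ (↭.prep e C∼D) (g ∷ gs) =
  let _ , g′ , e′ = GLiteral-≃ e g ; _ , gs′ , C′∼D′ = GClause-∼ C∼D gs
  in _ , g′ ∷ gs′ , ↭.prep e′ C′∼D′
GClause-∼ (↭.swap e₁ e₂ C∼D) (g₁ ∷ g₂ ∷ gs) =
  let _ , g₁′ , e₁′ = GLiteral-≃ e₁ g₁ ; _ , g₂′ , e₂′ = GLiteral-≃ e₂ g₂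
      _ , gs′ , C′∼D′ = GClause-∼ C∼D gs
  in _ , g₂′ ∷ g₁′ ∷ gs′ , ↭.swap e₁′ e₂′ C′∼D′
GClause-∼ (↭.trans C∼D D∼E) gs =
  let _ , gs′ , C′∼D′ = GClause-∼ C∼D gs ; _ , gs″ , D′∼E′ = GClause-∼ D∼E gs′
  in _ , gs″ , ↭.trans C′∼D′ D′∼E′

module _ {k} (I : Interpretation k) where

  open Interpretation I using (_≡ᴵ_) renaming (cong to ≡ᴵ-cong)
  private
    module ≡ᴵ = IsEquivalence (Interpretation.isEquivalence I)

  True-≃ : ∀ {K L} → K ≃ L → True I K → True I L
  True-≃         same          tr = tr
  True-≃ {s ≈ t} flip          tr = ≡ᴵ.sym tr
  True-≃ {s ≉ t} flip          tr = tr ∘ ≡ᴵ.sym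

  SatisfiesG-∼ : ∀ {C D} → C ∼ D → SatisfiesG I C → SatisfiesG I D
  SatisfiesG-∼ C∼D ¬¬C ¬D = ¬¬C (¬D ∘ ∼.Any-resp-↭ True-≃ C∼D)

  Satisfies-∼ : ∀ {C D} → C ∼ D → Satisfies I C → Satisfies I D
  Satisfies-∼ C∼D sat g =
    let _ , g′ , D′∼C′ = GClause-∼ (∼.↭-sym C∼D) g
    in SatisfiesG-∼ (∼.↭-sym D′∼C′) (sat g′)

  ++-cong : ∀ u {v w} → (v ⊥ᵗ) ≡ᴵ (w ⊥ᵗ) → ((u ++ v) ⊥ᵗ) ≡ᴵ ((u ++ w) ⊥ᵗ)
  ++-cong []      eq = eq
  ++-cong (a ∷ u) eq = ≡ᴵ-cong a (++-cong u eq)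

  Valid : Literal (Word k) → Set
  Valid L = ∀ {L′} → GLiteral L L′ → ¬ ¬ True I L′

  -- Each positive literal of a g-clause has its own suffix, so the g-literals of `C` can be held
  -- fixed and false while the head ranges over all its instances.
  valid-head : ∀ {L C C′} → Satisfies I (L ∷ C) → GClause C C′ → ¬ Any (True I) C′ → Valid L
  valid-head sat gs ¬C′ g ¬L′ = sat (g ∷ gs) λ where
    (here L′)  → ¬L′ L′
    (there C′) → ¬C′ C′

  -- A record because s and t could not be inferred through the fold _⊥ᵗ.
  record _↔ᴵ_ (s t : Word k) : Set where
    constructor ↔-intro
    field ↔-elim : ¬ ¬ ((s ⊥ᵗ) ≡ᴵ (t ⊥ᵗ))
  open _↔ᴵ_

  ↔-sym : ∀ {s t} → s ↔ᴵ t → t ↔ᴵ s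
  ↔-sym (↔-intro ¬¬p) = ↔-intro λ ¬q → ¬¬p (¬q ∘ ≡ᴵ.sym)

  ↔-trans : ∀ {s t u} → s ↔ᴵ t → t ↔ᴵ u → s ↔ᴵ u
  ↔-trans (↔-intro ¬¬p) (↔-intro ¬¬q) = ↔-intro λ ¬r → ¬¬p λ p → ¬¬q λ q → ¬r (≡ᴵ.trans p q)

  ↔-++ : ∀ u {s t} → s ↔ᴵ t → (u ++ s) ↔ᴵ (u ++ t)
  ↔-++ u (↔-intro ¬¬p) = ↔-intro λ ¬q → ¬¬p (¬q ∘ ++-cong u)

  valid-↔ : ∀ {s t} → Valid (s ≈ t) → ∀ w → (s ++ w) ↔ᴵ (t ++ w)
  valid-↔ L w = ↔-intro (L (positive w))

  valid-≃ : ∀ {K L} → K ≃ L → Valid K → Valid L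
  valid-≃ K≃L K g ¬L = let _ , g′ , e = GLiteral-≃ (≃-sym K≃L) g in
    K g′ (¬L ∘ True-≃ (≃-sym e))

  -- The premises with suffixes `u₃ ++ w` and `w` share the word `u₁ ++ u₂ ++ u₃ ++ w`; transitivity
  -- through it gives the conclusion.
  valid-superposition : ∀ u₁ u₂ u₃ s t → Valid (u₁ ++ u₂ ≈ s) → Valid (u₂ ++ u₃ ≈ t) →
                        Valid (u₁ ++ t ≈ s ++ u₃)
  valid-superposition u₁ u₂ u₃ s t P Q (positive w) =
    ↔-elim (subst₂ _↔ᴵ_ (sym (++-assoc u₁ t w)) (sym (++-assoc s u₃ w))
      (↔-trans (↔-++ u₁ (↔-sym (valid-↔ Q w)))
               (subst (_↔ᴵ (s ++ u₃ ++ w)) reassoc (valid-↔ P (u₃ ++ w)))))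
    where
    reassoc : (u₁ ++ u₂) ++ u₃ ++ w ≡ u₁ ++ (u₂ ++ u₃) ++ w
    reassoc = trans (++-assoc u₁ u₂ _) (cong (u₁ ++_) (sym (++-assoc u₂ u₃ w)))

  ++-assoc₃ : ∀ (u v w x : Word k) → (u ++ v ++ w) ++ x ≡ u ++ v ++ w ++ x
  ++-assoc₃ u v w x = trans (++-assoc u (v ++ w) x) (cong (u ++_) (++-assoc v w x))

  -- A positive conclusion with suffix `w` needs the second premise at `u₃ ++ w`; a negative literal
  -- carries no suffix, so there `u₃` is enough.
  valid-rewriting : ∀ ⋈ u₁ u₂ u₃ s t → Valid (lit ⋈ (u₁ ++ u₂ ++ u₃) s) → Valid (u₂ ≈ t) →
                    Valid (lit ⋈ (u₁ ++ t ++ u₃) s)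
  valid-rewriting pos u₁ u₂ u₃ s t P Q (positive w) =
    ↔-elim (↔-trans (subst₂ _↔ᴵ_ (sym (++-assoc₃ u₁ t u₃ w)) (sym (++-assoc₃ u₁ u₂ u₃ w))
                         (↔-++ u₁ (↔-sym (valid-↔ Q (u₃ ++ w)))))
            (valid-↔ P w))
  valid-rewriting neg u₁ u₂ u₃ s t P Q negative ¬N =
    P negative λ eq → ↔-elim (↔-++ u₁ (↔-sym (valid-↔ Q u₃))) λ eq′ → ¬N λ eq″ →
      eq (≡ᴵ.trans (≡ᴵ.sym eq′) eq″)

  GClause-++⁻ : ∀ C {D E′} → GClause {k} (C ++ D) E′ →
                ∃[ C′ ] ∃[ D′ ] E′ ≡ C′ ++ D′ × GClause C C′ × GClause D D′
  GClause-++⁻ []      gs       = [] , _ , refl , [] , gs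
  GClause-++⁻ (L ∷ C) (g ∷ gs) = let C′ , D′ , eq , gs₁ , gs₂ = GClause-++⁻ C gs in
    _ ∷ C′ , D′ , cong (_ ∷_) eq , g ∷ gs₁ , gs₂

  -- A g-clause of the conclusion contains g-clauses of `C` and of `D`. Refuting it refutes both,
  -- which makes the head of each premise valid and leaves only the relation between the three
  -- heads.
  binary : ∀ {L M N C D E P Q} → P ∼ L ∷ C → Q ∼ M ∷ D → E ∼ N ∷ C ++ D →
           (Valid L → Valid M → Valid N) → Satisfies I P → Satisfies I Q → Satisfies I E
  binary {C = C} P∼ Q∼ E∼ rule P Q = Satisfies-∼ (∼.↭-sym E∼) conclusion
    where
    conclusion : Satisfies I (_ ∷ C ++ _)
    conclusion (g ∷ gs) ¬E with _ , _ , refl , gs₁ , gs₂ ← GClause-++⁻ C gs =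
      rule (valid-head (Satisfies-∼ P∼ P) gs₁ (¬E ∘ there ∘ Any.++⁺ˡ))
           (valid-head (Satisfies-∼ Q∼ Q) gs₂ (¬E ∘ there ∘ Any.++⁺ʳ _))
           g (¬E ∘ here)

  Infer-sound : ∀ {_<_ : Rel (Fin k) 0ℓ} {Ps E} → Inference.Infer _<_ Ps E →
                All (Satisfies I ∘ clause) Ps → Satisfies I E
  Infer-sound (superposition C D u₁ u₂ u₃ s t P∼ Q∼ _ _ _ _ _ E∼) (P ∷ Q ∷ []) =
    binary P∼ Q∼ E∼ (valid-superposition u₁ u₂ u₃ s t) P Q
  Infer-sound (rewriting C D ⋈ u₁ u₂ u₃ s t P∼ Q∼ _ _ _ _ E∼) (P ∷ Q ∷ []) =
    binary P∼ Q∼ E∼ (valid-rewriting ⋈ u₁ u₂ u₃ s t) P Q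
  Infer-sound (equalityResolution C s P∼ _ E∼) (P ∷ []) =
    Satisfies-∼ (∼.↭-sym E∼) λ gs ¬C → Satisfies-∼ P∼ P (negative ∷ gs) λ where
      (here ¬s≡s) → ¬s≡s ≡ᴵ.refl
      (there C′)  → ¬C C′
  -- Paramodulation is superposition with the first premise and the conclusion turned around.
  Infer-sound (paramodulation C D u₁ u₂ u₃ s t P∼ Q∼ _ _ _ _ _ _ E∼) (P ∷ Q ∷ []) =
    binary P∼ Q∼ E∼
      (λ L M → valid-≃ flip (valid-superposition u₁ u₂ u₃ s t (valid-≃ flip L) M)) P Q
  Infer-sound (factoring C s t u P∼ _ E∼) (P ∷ []) =
    Satisfies-∼ (∼.↭-sym E∼) conclusion
    where
    conclusion : Satisfies I ((s ++ u ≈ t ++ u) ∷ C)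
    conclusion (positive w ∷ gs) ¬E =
      -- The suffix `u ++ w` for `s ≈ t` makes its instance coincide with that of `s ++ u ≈ t ++ u`
      -- at `w`.
      Satisfies-∼ P∼ P (positive (u ++ w) ∷ positive w ∷ gs) λ where
        (here eq) → ¬E (here (subst₂ (λ s t → (s ⊥ᵗ) ≡ᴵ (t ⊥ᵗ))
                                     (sym (++-assoc s u w)) (sym (++-assoc t u w)) eq))
        (there E′) → ¬E E′

-- Clauses with exactly one positive literal

positives : ∀ {T} → Clause T → ℕ
positives []            = 0
positives ((_ ≈ _) ∷ C) = suc (positives C)
positives ((_ ≉ _) ∷ C) = positives C

positives-++ : ∀ {T} (C D : Clause T) → positives (C ++ D) ≡ positives C + positives D
positives-++ []            D = refl
positives-++ ((_ ≈ _) ∷ C) D = cong suc (positives-++ C D)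
positives-++ ((_ ≉ _) ∷ C) D = positives-++ C D

positives-∷ : ∀ {T} {K L : Literal T} {C D} → K ≃ L → positives C ≡ positives D →
              positives (K ∷ C) ≡ positives (L ∷ D)
positives-∷ {K = _ ≈ _} same eq = cong suc eq
positives-∷ {K = _ ≉ _} same eq = eq
positives-∷ {K = _ ≈ _} flip eq = cong suc eq
positives-∷ {K = _ ≉ _} flip eq = eq

positives-swap : ∀ {T} (K L : Literal T) C → positives (K ∷ L ∷ C) ≡ positives (L ∷ K ∷ C)
positives-swap (_ ≈ _) (_ ≈ _) C = refl
positives-swap (_ ≈ _) (_ ≉ _) C = refl
positives-swap (_ ≉ _) (_ ≈ _) C = refl
positives-swap (_ ≉ _) (_ ≉ _) C = refl

positives-∼ : ∀ {T} {C D : Clause T} → C ∼ D → positives C ≡ positives D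
positives-∼ (↭.refl [])         = refl
positives-∼ (↭.refl (e ∷ es))   = positives-∷ e (positives-∼ (↭.refl es))
positives-∼ (↭.prep e p)        = positives-∷ e (positives-∼ p)
positives-∼ (↭.swap {x = K} {L} e₁ e₂ p) =
  trans (positives-swap K L _) (positives-∷ e₂ (positives-∷ e₁ (positives-∼ p)))
positives-∼ (↭.trans p q)       = trans (positives-∼ p) (positives-∼ q)

Definite : ∀ {T} → Clause T → Set
Definite C = positives C ≡ 1

definite-head : ∀ {T} {P C : Clause T} {s t} → P ∼ (s ≈ t) ∷ C → Definite P → positives C ≡ 0
definite-head P∼ P = ℕ.suc-injective (trans (sym (positives-∼ P∼)) P)

positives-++-≡ : ∀ {T} (C D : Clause T) {m} → positives C ≡ m → positives D ≡ 0 →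
                 positives (C ++ D) ≡ m
positives-++-≡ C D refl D≡0 =
  trans (positives-++ C D) (trans (cong (positives C +_) D≡0) (ℕ.+-identityʳ _))

-- A binary rule uses up the positive literal of its second premise and leaves the number in the
-- first unchanged; equality resolution removes a negative literal. Factoring would need two
-- positive literals in its premise.
Infer-definite : ∀ {A : Set} {_<_ : Rel A 0ℓ} {Ps E} → Inference.Infer _<_ Ps E →
                 All (Definite ∘ clause) Ps → Definite E
Infer-definite (superposition C D _ _ _ _ _ P∼ Q∼ _ _ _ _ _ E∼) (P ∷ Q ∷ []) =
  trans (positives-∼ E∼) (cong suc (positives-++-≡ C D (definite-head P∼ P) (definite-head Q∼ Q)))
Infer-definite (rewriting C D pos _ _ _ _ _ P∼ Q∼ _ _ _ _ E∼) (P ∷ Q ∷ []) =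
  trans (positives-∼ E∼) (cong suc (positives-++-≡ C D (definite-head P∼ P) (definite-head Q∼ Q)))
Infer-definite (rewriting C D neg _ _ _ _ _ P∼ Q∼ _ _ _ _ E∼) (P ∷ Q ∷ []) =
  trans (positives-∼ E∼) (positives-++-≡ C D (trans (sym (positives-∼ P∼)) P) (definite-head Q∼ Q))
Infer-definite (equalityResolution C s P∼ _ E∼) (P ∷ []) =
  trans (positives-∼ E∼) (trans (sym (positives-∼ P∼)) P)
Infer-definite (paramodulation C D _ _ _ _ _ P∼ Q∼ _ _ _ _ _ _ E∼) (P ∷ Q ∷ []) =
  trans (positives-∼ E∼) (cong suc (positives-++-≡ C D (definite-head P∼ P) (definite-head Q∼ Q)))
Infer-definite (factoring C s t u P∼ _ E∼) (P ∷ []) with () ← definite-head P∼ P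

definite-cases : ∀ {T} (C : Clause T) → Definite C →
                 Any Negative C ⊎ ∃[ s ] ∃[ t ] C ≡ (s ≈ t) ∷ []
definite-cases ((s ≉ t) ∷ C)           _ = inj₁ (here negative)
definite-cases ((s ≈ t) ∷ [])          _ = inj₂ (s , t , refl)
definite-cases ((s ≈ t) ∷ (_ ≉ _) ∷ C) _ = inj₁ (there (here negative))

conditionalEquation⇒definite : ∀ {k} {C : Clause (Word k)} → ConditionalEquation C → Definite C
conditionalEquation⇒definite ce = trans (positives-∼ shape) (conditions-negative conditions)
  where
  open ConditionalEquation ce
  conditions-negative : ∀ cs → positives (map (λ (s , t) → s ≉ t) cs ++ (l ≈ r) ∷ []) ≡ 1
  conditions-negative []       = refl
  conditions-negative (_ ∷ cs) = conditions-negative cs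

-- The ordering on g-clauses and ground inferences

∈ᶜ⇒∼ : ∀ {T} {L : Literal T} {C} → L ∈ᶜ C → ∃[ D ] C ∼ L ∷ D
∈ᶜ⇒∼ {C = _ ∷ C} (here L≃K) = C , ↭.prep (≃-sym L≃K) ∼.↭-refl
∈ᶜ⇒∼ {C = K ∷ _} (there p) = let D , C∼ = ∈ᶜ⇒∼ p in
  K ∷ D , ↭.trans (∼.↭-prep K C∼) (∼.↭-swap K _ ∼.↭-refl)

mapLiteral-≃ : ∀ {T U : Set} (f : T → U) {K L} → K ≃ L → mapLiteral f K ≃ mapLiteral f L
mapLiteral-≃ f same = same
mapLiteral-≃ f flip = flip

mapLiteral-∼ : ∀ {T U : Set} (f : T → U) {C D} → C ∼ D → map (mapLiteral f) C ∼ map (mapLiteral f) D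
mapLiteral-∼ f = ∼.map⁺ (literalSetoid _) (mapLiteral-≃ f)

noneSelectedIn-[] : ∀ {T} (P : Premise T) → NoneSelectedIn [] P
noneSelectedIn-[] (premise C nothing)  = Maybe.nothing
noneSelectedIn-[] (premise C (just L)) = Maybe.just λ ()

isSelectedIn-map : ∀ {T U} (f : T → U) P {L} → IsSelectedIn L P →
                   IsSelectedIn (mapLiteral f L) (mapPremise f P)
isSelectedIn-map f (premise _ (just _)) (Maybe.just L≃) = Maybe.just (mapLiteral-≃ f L≃)

∼-reflexive : ∀ {T} {C D : Clause T} → C ≡ D → C ∼ D
∼-reflexive refl = ∼.↭-refl

module GroundOrder {k} (_<_ : Rel (Fin k) 0ℓ) (<-isSTO : IsStrictTotalOrder _≡_ _<_)
                   (sel : Selection k) where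

  open WordOrder _<_ <-isSTO
  open Saturation _<_ sel using (_≻ᵍ_; _≻ᶜ_; literalMultiset)

  private
    termSetoid = setoid (GTerm k)

    ≻ᵍ-respˡ : _≻ᵍ_ Respectsˡ _≡_
    ≻ᵍ-respˡ refl p≻x = p≻x

    multisetSetoid = Permutation.↭-setoid termSetoid

    module M₁ = MultisetOrder termSetoid _≻ᵍ_ ≻ᵍ-respˡ
    module M₂ = MultisetOrder multisetSetoid M₁._≻ᵐ_ M₁.≻ᵐ-respˡ
    module M₃ = MultisetOrder (Permutation.↭-setoid multisetSetoid) M₂._≻ᵐ_ M₂.≻ᵐ-respˡ

  ≻ᶜ-wellFounded : WellFounded (F.flip _≻ᶜ_)
  ≻ᶜ-wellFounded = On.wellFounded (map literalMultiset)
    (M₃.≻ᵐ-wellFounded (M₂.≻ᵐ-wellFounded (M₁.≻ᵐ-wellFounded ≻ᵍ-wellFounded)))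

  ≻ᶜ-irrefl : ∀ C → ¬ (C ≻ᶜ C)
  ≻ᶜ-irrefl C = wf⇒irrefl ≻ᶜ-wellFounded {C}

  ≻ᶜ-asym : ∀ C D → C ≻ᶜ D → ¬ (D ≻ᶜ C)
  ≻ᶜ-asym C D C≻D D≻C = wf⇒asym ≻ᶜ-wellFounded {C} {D} D≻C C≻D

  private
    open module ↭₁ = Permutation termSetoid using () renaming (_↭_ to _↭₁_)
    open module ↭₂ = Permutation multisetSetoid using () renaming (_↭_ to _↭₂_)

    literalMultiset-≃ : ∀ {K L} → K ≃ L → literalMultiset K ↭₂ literalMultiset L
    literalMultiset-≃         same = ↭₂.↭-refl
    literalMultiset-≃ {_ ≈ _} flip = ↭₂.↭-swap _ _ ↭₂.↭-refl
    literalMultiset-≃ {_ ≉ _} flip = ↭₂.refl (↭₁.↭-swap _ _ ↭₁.↭-refl ∷ [])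

  ≻ᶜ-respˡ : ∀ {C D X} → C ∼ D → C ≻ᶜ X → D ≻ᶜ X
  ≻ᶜ-respˡ C∼D = M₃.≻ᵐ-respˡ
    (∼.map⁺ (Permutation.↭-setoid multisetSetoid) literalMultiset-≃ C∼D)

  private
    -- A negative literal is a single two-element multiset, so dropping `q` already gives a strict
    -- decrease when `x` equals `p`.
    pair-≻ : ∀ {p q x} → p ≡ x ⊎ p ≻ᵍ x → (p ∷ q ∷ []) M₁.≻ᵐ (x ∷ [])
    pair-≻ {p} {q} (inj₁ refl) = record
      { kept = p ∷ [] ; removed = q ∷ [] ; added = [] ; removed-nonempty = λ ()
      ; M-split = ↭₁.↭-refl ; N-split = ↭₁.↭-refl ; dominated = [] }
    pair-≻ {p} {q} {x} (inj₂ p≻x) = record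
      { kept = [] ; removed = p ∷ q ∷ [] ; added = x ∷ [] ; removed-nonempty = λ ()
      ; M-split = ↭₁.↭-refl ; N-split = ↭₁.↭-refl ; dominated = here p≻x ∷ [] }

    singleton-≻ : ∀ {p x} → p ≻ᵍ x → (p ∷ []) M₁.≻ᵐ (x ∷ [])
    singleton-≻ {p} {x} p≻x = record
      { kept = [] ; removed = p ∷ [] ; added = x ∷ [] ; removed-nonempty = λ ()
      ; M-split = ↭₁.↭-refl ; N-split = ↭₁.↭-refl ; dominated = here p≻x ∷ [] }

    ≉-≻-≈ : ∀ {p q x y} → p ≡ x ⊎ p ≻ᵍ x → p ≡ y ⊎ p ≻ᵍ y →
            literalMultiset (p ≉ q) M₂.≻ᵐ literalMultiset (x ≈ y)
    ≉-≻-≈ {p} {q} {x} {y} p≽x p≽y = record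
      { kept = [] ; removed = literalMultiset (p ≉ q) ; added = literalMultiset (x ≈ y)
      ; removed-nonempty = λ () ; M-split = ↭₂.↭-refl ; N-split = ↭₂.↭-refl
      ; dominated = here (pair-≻ p≽x) ∷ here (pair-≻ p≽y) ∷ [] }

    open module ↭₃ = Permutation (Permutation.↭-setoid multisetSetoid) using ()

    unit-≻-unit : ∀ K L → literalMultiset K M₂.≻ᵐ literalMultiset L → (K ∷ []) ≻ᶜ (L ∷ [])
    unit-≻-unit K L K≻L = record
      { kept = [] ; removed = literalMultiset K ∷ [] ; added = literalMultiset L ∷ []
      ; removed-nonempty = λ () ; M-split = ↭₃.↭-refl ; N-split = ↭₃.↭-refl
      ; dominated = here K≻L ∷ [] }

  -- The one negative literal dominates both sides of `x ≈ y`; the rest of `C` is removed with it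
  -- and only enlarges the left-hand side.
  negative-≻-unit : ∀ {C C′ p q x y} → C ∼ (p ≉ q) ∷ C′ → p ≡ x ⊎ p ≻ᵍ x → p ≡ y ⊎ p ≻ᵍ y →
                    C ≻ᶜ ((x ≈ y) ∷ [])
  negative-≻-unit {C′ = C′} {p} {q} {x} {y} C∼ p≽x p≽y =
    ≻ᶜ-respˡ {X = (x ≈ y) ∷ []} (∼.↭-sym C∼) record
    { kept = []
    ; removed = map literalMultiset ((p ≉ q) ∷ C′)
    ; added = literalMultiset (x ≈ y) ∷ []
    ; removed-nonempty = λ () ; M-split = ↭₃.↭-refl ; N-split = ↭₃.↭-refl
    ; dominated = here (≉-≻-≈ p≽x p≽y) ∷ [] }

  unit-≻-lhs : ∀ {p q x y} → p ≻ᵍ x → p ≻ᵍ y → ((p ≈ q) ∷ []) ≻ᶜ ((x ≈ y) ∷ [])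
  unit-≻-lhs {p} {q} {x} {y} p≻x p≻y = unit-≻-unit (p ≈ q) (x ≈ y) record
    { kept = [] ; removed = literalMultiset (p ≈ q) ; added = literalMultiset (x ≈ y)
    ; removed-nonempty = λ () ; M-split = ↭₂.↭-refl ; N-split = ↭₂.↭-refl
    ; dominated = here (singleton-≻ p≻x) ∷ here (singleton-≻ p≻y) ∷ [] }

  unit-≻-rhs : ∀ {p q y} → q ≻ᵍ y → ((p ≈ q) ∷ []) ≻ᶜ ((p ≈ y) ∷ [])
  unit-≻-rhs {p} {q} {y} q≻y = unit-≻-unit (p ≈ q) (p ≈ y) record
    { kept = (p ∷ []) ∷ [] ; removed = (q ∷ []) ∷ [] ; added = (y ∷ []) ∷ []
    ; removed-nonempty = λ () ; M-split = ↭₂.↭-refl ; N-split = ↭₂.↭-refl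
    ; dominated = here (singleton-≻ q≻y) ∷ [] }

  open Infimum _<_ using (_<₋_)

  -- A g-term ends in `⊥`, so a ground rule matches only at the end of a string: the right context
  -- is empty and `u` is the left one. The same ground inference later serves as g-instance of both
  -- Rewrite and Superposition.
  ground-rewriting : ∀ P {E} ⋈ u x y z C → clause P ∼ lit ⋈ ((u ++ x) ⊥ᵗ) z ∷ C →
    (⋈ ≡ neg → IsSelectedIn (lit ⋈ ((u ++ x) ⊥ᵗ) z) P) → (⋈ ≡ pos → C ≡ []) → x ≻ y →
    E ∼ lit ⋈ ((u ++ y) ⊥ᵗ) z ∷ C →
    Infer _<₋_ (map (mapPremise string) (P ∷ premise ((x ⊥ᵗ ≈ y ⊥ᵗ) ∷ []) nothing ∷ []))
               (map (mapLiteral string) E)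
  ground-rewriting P ⋈ u x y z C P∼ selected C≡[] x≻y E∼ =
    rewriting (map (mapLiteral string) C) [] ⋈
      (map [_] u) (string (x ⊥ᵗ)) [] (string z) (string (y ⊥ᵗ))
      (↭.trans (mapLiteral-∼ string P∼)
        (∼-reflexive (cong (λ s → lit ⋈ s (string z) ∷ _) (string-context x))))
      ∼.↭-refl
      (λ { refl → subst (λ s → IsSelectedIn (s ≉ string z) (mapPremise string P)) (string-context x)
                        (isSelectedIn-map string P (selected refl)) })
      (λ ⋈≡pos → subst (λ C → NoneSelectedIn (map (mapLiteral string) C) (mapPremise string P))
                       (sym (C≡[] ⋈≡pos)) (noneSelectedIn-[] (mapPremise string P)))
      Maybe.nothing
      (⊥ᵗ-≻ x≻y)
      (↭.trans (mapLiteral-∼ string E∼) (∼-reflexive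
        (cong₂ (λ s D → lit ⋈ s (string z) ∷ D) (string-context y) (sym (++-identityʳ _)))))
    where
    string-context : ∀ x → string ((u ++ x) ⊥ᵗ) ≡ map [_] u ++ string (x ⊥ᵗ) ++ []
    string-context x = trans (string-++ u) (cong (map [_] u ++_) (sym (++-identityʳ _)))


  ground-equalityResolution : ∀ P p C → clause P ∼ (p ≉ p) ∷ C → IsSelectedIn (p ≉ p) P →
    Infer _<₋_ (map (mapPremise string) (P ∷ [])) (map (mapLiteral string) C)
  ground-equalityResolution P p C P∼ s =
    equalityResolution (map (mapLiteral string) C) (string p) (mapLiteral-∼ string P∼)
      (isSelectedIn-map string P s) ∼.↭-refl

-- Derivations and the model of the limit

module FiniteDerivation {k} (_<_ : Rel (Fin k) 0ℓ) (<-isSTO : IsStrictTotalOrder _≡_ _<_)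
  (sel : Selection k) {R : ClauseSet k} (theory : ConditionalEquationalTheory R)
  {n} {S : Saturation.Sequence _<_ sel n} (S₀≐R : S zero ≐ R)
  (derivation : Saturation.Derivation _<_ sel S) where

  open Saturation _<_ sel
  open Selection sel
  open ConditionalEquationalTheory theory
  open GroundOrder _<_ <-isSTO sel

  R⊆union : R ⊆ union S
  R⊆union C∈R = zero , proj₂ S₀≐R C∈R

  private
    selectPremise : Clause (Word k) → Premise (Word k)
    selectPremise C = premise C (select C)

  stage-closed : ∀ i → S i Respects _∼_
  stage-closed = <-weakInduction _
    (λ C∼D → proj₂ S₀≐R ∘ closed C∼D ∘ proj₁ S₀≐R)
    (λ i ih → step (derivation i) ih)
    where
    step : ∀ {A B} → Step A B → A Respects _∼_ → B Respects _∼_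
    step (deduction _ _ _ _ B≐) closedᴬ C∼D C∈B with proj₁ B≐ C∈B
    ... | inj₁ C∈A = proj₂ B≐ (inj₁ (closedᴬ C∼D C∈A))
    ... | inj₂ C∼E = proj₂ B≐ (inj₂ (↭.trans (∼.↭-sym C∼D) C∼E))
    step (deletion _ _ B≐) closedᴬ C∼D C∈B with proj₁ B≐ C∈B
    ... | C∈A , C≁E = proj₂ B≐ (closedᴬ C∼D C∈A , C≁E ∘ ↭.trans C∼D)

  stage-definite : ∀ i → S i ⊆ Definite
  stage-definite = <-weakInduction _
    (conditionalEquation⇒definite ∘ conditional ∘ proj₁ S₀≐R)
    (λ i ih → step (derivation i) ih)
    where
    step : ∀ {A B} → Step A B → A ⊆ Definite → B ⊆ Definite
    step (deduction Cs _ Cs⊆A inf B≐) defᴬ C∈B with proj₁ B≐ C∈B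
    ... | inj₁ C∈A = defᴬ C∈A
    ... | inj₂ C∼E = trans (positives-∼ C∼E) (Infer-definite inf (All.map⁺ (All.map defᴬ Cs⊆A)))
    step (deletion _ _ B≐) defᴬ C∈B = defᴬ (proj₁ (proj₁ B≐ C∈B))

  stage-sound : ∀ I → R ⊆ Satisfies I → ∀ i → S i ⊆ Satisfies I
  stage-sound I R⊆I = <-weakInduction _ (R⊆I ∘ proj₁ S₀≐R) (λ i ih → step (derivation i) ih)
    where
    step : ∀ {A B} → Step A B → A ⊆ Satisfies I → B ⊆ Satisfies I
    step (deduction _ _ Cs⊆A inf B≐) A⊆I C∈B with proj₁ B≐ C∈B
    ... | inj₁ C∈A = A⊆I C∈A
    ... | inj₂ C∼E = Satisfies-∼ I (∼.↭-sym C∼E) (Infer-sound I inf (All.map⁺ (All.map A⊆I Cs⊆A)))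
    step (deletion _ _ B≐) A⊆I C∈B = A⊆I (proj₁ (proj₁ B≐ C∈B))

  Redundant-∼ : ∀ {A : ClauseSet k} {C D} → C ∼ D → Redundant A C → Redundant A D
  Redundant-∼ C∼D red g =
    let C′ , g′ , D′∼C′ = GClause-∼ (∼.↭-sym C∼D) g ; Cs , gs , entails , below = red g′
    in Cs , gs , (λ I → SatisfiesG-∼ I (∼.↭-sym D′∼C′) ∘ entails I)
     , All.map (≻ᶜ-respˡ (∼.↭-sym D′∼C′)) below

  Redundant-⊆ : ∀ {A B : ClauseSet k} {C} → A ⊆ B → Redundant A C → Redundant B C
  Redundant-⊆ A⊆B red g =
    let Cs , gs , entails , below = red g
    in Cs , All.map (λ (C , C∈A , g) → C , A⊆B C∈A , g) gs , entails , below

  -- Induction from the last stage backwards: a clause survives a step or is the deleted one, and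
  -- redundancy with respect to a stage persists in the union. Which case holds is not decided,
  -- hence the double negation.
  limit⊎redundant : ∀ i {C} → C ∈ S i → ¬ ¬ (C ∈ limit S ⊎ Redundant (union S) C)
  limit⊎redundant = >-weakInduction _ (λ C∈S ¬X → ¬X (inj₁ C∈S))
    (λ i ih → step (derivation i) (λ C∈A → inject₁ i , C∈A) ih)
    where
    step : ∀ {A B} → Step A B → A ⊆ union S →
           (∀ {C} → C ∈ B → ¬ ¬ (C ∈ limit S ⊎ Redundant (union S) C)) →
           ∀ {C} → C ∈ A → ¬ ¬ (C ∈ limit S ⊎ Redundant (union S) C)
    step (deduction _ _ _ _ B≐) _ ih C∈A = ih (proj₂ B≐ (inj₁ C∈A))
    step (deletion D red B≐) A⊆ ih C∈A ¬X = ih (proj₂ B≐ (C∈A , λ C∼D →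
      ¬X (inj₂ (Redundant-∼ (∼.↭-sym C∼D) (Redundant-⊆ A⊆ red))))) ¬X

  limit-closed : limit S Respects _∼_
  limit-closed = stage-closed (fromℕ n)

  limit-definite : limit S ⊆ Definite
  limit-definite = stage-definite (fromℕ n)

  limit-sound : ∀ I → R ⊆ Satisfies I → limit S ⊆ Satisfies I
  limit-sound I R⊆I = stage-sound I R⊆I (fromℕ n)

  open WordOrder _<_ <-isSTO

  -- The normal-form model of a saturated limit

  module SaturatedLimit (fair : Fair S)
    (ρs : List (Rule k))
    (ρs-decreasing : ∀ {l r} → (l , r) ∈ˡ ρs → l ≻ r)
    (ρs-sound : ∀ {l r} → (l , r) ∈ˡ ρs → ((l ≈ r) ∷ []) ∈ limit S)
    (ρs-complete : ∀ {l r} → l ≻ r → ((l ≈ r) ∷ []) ∈ limit S → (l , r) ∈ˡ ρs) where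

    open Normalisation _<_ <-isSTO ρs ρs-decreasing

    model : Interpretation k
    model = record
      { _≡ᴵ_          = λ p q → nf (toWord p) ≡ nf (toWord q)
      ; isEquivalence = record { refl = refl ; sym = sym ; trans = trans }
      ; cong          = λ a → nf-∷ a
      }

    model-≡⇒nf : ∀ s t → nf (toWord (s ⊥ᵗ)) ≡ nf (toWord (t ⊥ᵗ)) → nf s ≡ nf t
    model-≡⇒nf s t = subst₂ (λ s t → nf s ≡ nf t) (toWord-⊥ᵗ s) (toWord-⊥ᵗ t)

    nf⇒model-≡ : ∀ s t → nf s ≡ nf t → nf (toWord (s ⊥ᵗ)) ≡ nf (toWord (t ⊥ᵗ))
    nf⇒model-≡ s t = subst₂ (λ s t → nf s ≡ nf t) (sym (toWord-⊥ᵗ s)) (sym (toWord-⊥ᵗ t))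

    infix 4 _≟_
    _≟_ : (s t : Word k) → Dec (s ≡ t)
    _≟_ = ≡-dec Fin._≟_

    -- Equality of words is decidable, so the double negation in satisfaction can be removed.
    unit-true : ∀ s t → SatisfiesG model ((s ⊥ᵗ ≈ t ⊥ᵗ) ∷ []) → nf s ≡ nf t
    unit-true s t sat = decidable-stable (nf s ≟ nf t) λ nf≢ → sat λ where
      (here eq) → nf≢ (model-≡⇒nf s t eq)

    unitᵍ : Word k → Word k → Clause (GTerm k)
    unitᵍ s t = (s ⊥ᵗ ≈ t ⊥ᵗ) ∷ []

    -- The induction hypothesis of the model construction. It ranges over the union, since the
    -- g-clauses witnessing redundancy come from there and not only from the limit.
    TrueBelow : Clause (GTerm k) → Set
    TrueBelow B = ∀ {C C′} → C ∈ union S → GClause C C′ → B ≻ᶜ C′ → SatisfiesG model C′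

    TrueBelow-∼ : ∀ {B D} → B ∼ D → TrueBelow B → TrueBelow D
    TrueBelow-∼ B∼D below C∈ g D≻C′ = below C∈ g (≻ᶜ-respˡ (∼.↭-sym B∼D) D≻C′)

    -- This is how redundancy enters: the entailing g-clauses lie below the bound and are true by
    -- the induction hypothesis.
    entailed-true : ∀ B {D} → TrueBelow B → EntailedBelow (union S) B D → SatisfiesG model D
    entailed-true _ below (Cs , gs , entails , ≻Cs) =
      entails model (All.zipWith (λ ((C , C∈ , g) , B≻) → below C∈ g B≻) (gs , ≻Cs))

    select-unit : ∀ l r → select ((l ≈ r) ∷ []) ≡ nothing
    select-unit l r with select ((l ≈ r) ∷ []) in eq
    ... | nothing = refl
    ... | just L with select-negative eq
    ...   | negative , here ()

    unitPremise : Word k → Word k → Premise (GTerm k)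
    unitPremise s t = premise (unitᵍ s t) nothing

    unit-GPremise : ∀ l r w → GPremise ((l ≈ r) ∷ []) (unitPremise (l ++ w) (r ++ w))
    unit-GPremise l r w = record
      { isGClause = positive w ∷ []
      ; inherited = subst (λ m → Maybe.Pointwise GLiteral m nothing) (sym (select-unit l r))
                          Maybe.nothing }

    limit⊆union : limit S ⊆ union S
    limit⊆union C∈ = fromℕ n , C∈

    -- Truth of oriented unit equations

    module _ {l r} (lr : (l , r) ∈ˡ ρs) w (below : TrueBelow (unitᵍ (l ++ w) (r ++ w))) where

      private
        lw≻rw : l ++ w ≻ r ++ w
        lw≻rw = ≻-++ʳ w (ρs-decreasing lr)

        -- The induction hypothesis is available only below the first premise, which must therefore
        -- be maximal. For nonempty `u` its left-hand side exceeds both sides of the second premise;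
        -- for empty `u` the left-hand sides agree and the least contractum decides.
        first-maximal : ∀ u {l′ w′ r′} → l ++ w ≡ u ++ l′ ++ w′ → LeastRedex l′ w′ r′ →
          ¬ (unitᵍ (l′ ++ w′) (r′ ++ w′) ≻ᶜ unitᵍ (l ++ w) (r ++ w))
        first-maximal (a ∷ u) {l′} {w′} {r′} lw≡ red =
          ≻ᶜ-asym (unitᵍ (l ++ w) (r ++ w)) (unitᵍ (l′ ++ w′) (r′ ++ w′))
            (unit-≻-lhs (⊥ᵗ-≻ lw≻l′w′) (⊥ᵗ-≻ (≻-trans lw≻l′w′ (≻-++ʳ w′ (ρs-decreasing rule)))))
          where
          open LeastRedex red
          lw≻l′w′ : l ++ w ≻ l′ ++ w′
          lw≻l′w′ = subst (_≻ l′ ++ w′) (sym lw≡) (++-≻ a u (l′ ++ w′))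
        first-maximal [] {l′} {w′} {r′} lw≡ red
          with LeastRedex.least-contractum red (contract l r w lr (sym lw≡) refl)
        ... | inj₁ rw≡ rewrite lw≡ | rw≡ = ≻ᶜ-irrefl (unitᵍ (l′ ++ w′) (r′ ++ w′))
        ... | inj₂ rw≻ rewrite lw≡ =
          ≻ᶜ-asym (unitᵍ (l′ ++ w′) (r ++ w)) (unitᵍ (l′ ++ w′) (r′ ++ w′))
            (unit-≻-rhs (⊥ᵗ-≻ rw≻))

      module _ {u l′ w′ r′} (lw≡ : l ++ w ≡ u ++ l′ ++ w′) (red : LeastRedex l′ w′ r′) where

        open LeastRedex red

        private
          l′w′≻r′w′ : l′ ++ w′ ≻ r′ ++ w′
          l′w′≻r′w′ = ≻-++ʳ w′ (ρs-decreasing rule)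

          nf-contract : nf (l ++ w) ≡ nf (u ++ r′ ++ w′)
          nf-contract = trans (cong nf lw≡) (nf-++ u equal)

          -- Common end of the two overlap cases: fairness makes the ground conclusion true, and
          -- contracting the redex does not change the normal form of `l ++ w`.
          via-inference : ∀ {D} → Inf (((l ≈ r) ∷ []) ∷ ((l′ ≈ r′) ∷ []) ∷ []) D →
                          GClause D (((u ++ r′ ++ w′) ⊥ᵗ ≈ (r ++ w) ⊥ᵗ) ∷ []) →
                          nf (l ++ w) ≡ nf (r ++ w)
          via-inference {D} inf g =
            trans nf-contract (unit-true _ _
              (entailed-true (unitᵍ (l ++ w) (r ++ w)) below entailed))
            where
            entailed : EntailedBelow (union S) (unitᵍ (l ++ w) (r ++ w))
                                     (unitᵍ (u ++ r′ ++ w′) (r ++ w))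
            entailed = fair _ D (ρs-sound lr ∷ ρs-sound rule ∷ []) inf
              record
                { premises   = unit-GPremise l r w ∷ unit-GPremise l′ r′ w′ ∷ []
                ; conclusion = g
                ; inference  = ground-rewriting (unitPremise (l ++ w) (r ++ w)) pos
                    u (l′ ++ w′) (r′ ++ w′) ((r ++ w) ⊥ᵗ) []
                    (∼-reflexive (cong (λ s → unitᵍ s (r ++ w)) lw≡)) (λ ()) (λ _ → refl)
                    l′w′≻r′w′ ∼.↭-refl
                }
              (here refl , ≻ᶜ-irrefl (unitᵍ (l ++ w) (r ++ w)) ∷ first-maximal u lw≡ red ∷ [])

          -- The redex ends within `l`: the inference is Rewrite, and its conclusion is taken with
          -- suffix `w`.
          inside : ∀ v → l ≡ u ++ l′ ++ v → w′ ≡ v ++ w → nf (l ++ w) ≡ nf (r ++ w)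
          inside v l≡ w′≡ = via-inference
            (rewriting [] [] pos u l′ v r r′ (∼-reflexive (cong (λ s → (s ≈ r) ∷ []) l≡)) ∼.↭-refl
              (λ ()) (λ _ → noneSelectedIn-[] (selectPremise _))
              (noneSelectedIn-[] (selectPremise _)) (ρs-decreasing rule) ∼.↭-refl)
            (subst (λ s → GClause ((u ++ r′ ++ v ≈ r) ∷ []) ((s ⊥ᵗ ≈ (r ++ w) ⊥ᵗ) ∷ [])) eq
                   (positive w ∷ []))
            where
            eq : (u ++ r′ ++ v) ++ w ≡ u ++ r′ ++ w′
            eq = trans (++-assoc u (r′ ++ v) w)
                       (cong (u ++_) (trans (++-assoc r′ v w) (cong (r′ ++_) (sym w′≡))))

          -- The redex begins in `l` and may run on into `w`: the inference is Superposition, and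
          -- its conclusion is taken with the remaining suffix `w′`.
          overlapping : ∀ u₂ u₃ → u₂ ≢ [] → l ≡ u ++ u₂ → l′ ≡ u₂ ++ u₃ → w ≡ u₃ ++ w′ →
                        nf (l ++ w) ≡ nf (r ++ w)
          overlapping u₂ u₃ u₂≢[] l≡ l′≡ w≡ = via-inference
            (superposition [] [] u u₂ u₃ r r′
              (∼-reflexive (cong (λ s → (s ≈ r) ∷ []) l≡))
              (∼-reflexive (cong (λ s → (s ≈ r′) ∷ []) l′≡))
              u₂≢[] (noneSelectedIn-[] (selectPremise _)) (noneSelectedIn-[] (selectPremise _))
              (subst (_≻ r) l≡ (ρs-decreasing lr))
              (subst (_≻ r′) l′≡ (ρs-decreasing rule)) ∼.↭-refl)
            (subst₂ (λ s t → GClause ((u ++ r′ ≈ r ++ u₃) ∷ []) ((s ⊥ᵗ ≈ t ⊥ᵗ) ∷ []))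
                    (++-assoc u r′ w′) (trans (++-assoc r u₃ w′) (cong (r ++_) (sym w≡)))
                    (positive w′ ∷ []))

          -- The redex lies in w, so that the g-clause of l ≈ r at the reduced w is smaller.
          disjoint : ∀ v → w ≡ v ++ l′ ++ w′ → nf (l ++ w) ≡ nf (r ++ w)
          disjoint v w≡ = trans (nf-++ l nf-w) (trans smaller (nf-++ r (sym nf-w)))
            where
            v′ = v ++ r′ ++ w′
            nf-w : nf w ≡ nf v′
            nf-w = trans (cong nf w≡) (nf-++ v equal)
            w≻v′ : w ≻ v′
            w≻v′ = subst (_≻ v′) (sym w≡) (≻-++ˡ v l′w′≻r′w′)
            smaller : nf (l ++ v′) ≡ nf (r ++ v′)
            smaller = unit-true _ _ (below (limit⊆union (ρs-sound lr)) (positive v′ ∷ [])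
              (unit-≻-lhs (⊥ᵗ-≻ (≻-++ˡ l w≻v′)) (⊥ᵗ-≻ (≻-trans lw≻rw (≻-++ˡ r w≻v′)))))

        overlap-cases : nf (l ++ w) ≡ nf (r ++ w)
        overlap-cases with ++-split l u lw≡
        ... | inj₂ (v , _ , w≡) = disjoint v w≡
        ... | inj₁ (u₂ , l≡ , l′w′≡) with ++-split l′ u₂ l′w′≡
        ...   | inj₂ (v , refl , w′≡) = inside v l≡ w′≡
        ...   | inj₁ (u₃ , l′≡ , w≡) with u₂
        ...     | a ∷ u₂′ = overlapping (a ∷ u₂′) u₃ (λ ()) l≡ l′≡ w≡
        -- Here the redex begins exactly where `l` ends, so there is no overlap for Superposition.
        ...     | [] = disjoint [] (sym l′w′≡)

      -- `l` itself is a redex, so the strategy contracts something in `l ++ w`; the position of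
      -- that redex decides the case.
      oriented-true : nf (l ++ w) ≡ nf (r ++ w)
      oriented-true with redex⇒Reducible (contract l r w lr refl refl)
      ... | reducible u l′ w′ r′ lw≡ red = overlap-cases {u} lw≡ red

    -- Truth of clauses with a selected literal

    module _ {C C′ L} (C∈limit : C ∈ limit S) (select≡L : select C ≡ just L)
             (g : GClause C C′) (below : TrueBelow C′) where

      module _ {u v D D′} (L≃ : L ≃ (u ≉ v)) (C∼ : C ∼ (u ≉ v) ∷ D)
               (gs : GClause D D′) (C′∼ : C′ ∼ (u ⊥ᵗ ≉ v ⊥ᵗ) ∷ D′) where

        private
          inheritedLiteral : ∃[ L′ ] GLiteral L L′ × (u ⊥ᵗ ≉ v ⊥ᵗ) ≃ L′
          inheritedLiteral = GLiteral-≃ (≃-sym L≃) negative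

          P : Premise (GTerm k)
          P = premise C′ (just (proj₁ inheritedLiteral))

          P-GPremise : GPremise C P
          P-GPremise = record
            { isGClause = g
            ; inherited = subst (λ m → Maybe.Pointwise GLiteral m (selected P)) (sym select≡L)
                                (Maybe.just (proj₁ (proj₂ inheritedLiteral))) }

          selectedᵍ : IsSelectedIn (u ⊥ᵗ ≉ v ⊥ᵗ) P
          selectedᵍ = Maybe.just (proj₂ (proj₂ inheritedLiteral))

          selected′ : IsSelectedIn (u ≉ v) (selectPremise C)
          selected′ = subst (Maybe.Any ((u ≉ v) ≃_)) (sym select≡L) (Maybe.just (≃-sym L≃))

          rest-true : SatisfiesG model D′ → SatisfiesG model C′
          rest-true sat = SatisfiesG-∼ model (∼.↭-sym C′∼) λ ¬C′ → sat (¬C′ ∘ there)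

        -- The remaining literals form the conclusion of Equality Resolution, whose redundancy makes
        -- them true.
        trivial-true : u ≡ v → SatisfiesG model C′
        trivial-true refl = rest-true (entailed-true C′ below
          (fair _ _ (C∈limit ∷ [])
            (equalityResolution D u C∼ selected′ ∼.↭-refl)
            record { premises = P-GPremise ∷ [] ; conclusion = gs
                   ; inference = ground-equalityResolution P (u ⊥ᵗ) D′ C′∼ selectedᵍ }
            (here refl , ≻ᶜ-irrefl C′ ∷ [])))

        -- Rewriting `u` yields a true conclusion whose head is still false in the model, so the
        -- truth lies in `D′`. The g-clause of the rule cannot exceed `C′`, even if the redex is all
        -- of `u`, because the selected literal is negative.
        reducible-true : Reducible u → nf u ≡ nf v → SatisfiesG model C′
        reducible-true (reducible x l w r refl red) nf≡ = rest-true λ ¬D′ →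
          entailed-true C′ below conclusion-entailed λ where
            (here nf≢)  → nf≢ (nf⇒model-≡ (x ++ r ++ w) v (trans (sym (nf-++ x equal)) nf≡))
            (there D′-true) → ¬D′ D′-true
          where
          open LeastRedex red
          lw≻rw : l ++ w ≻ r ++ w
          lw≻rw = ≻-++ʳ w (ρs-decreasing rule)
          u≽lw : ∀ x → (x ++ l ++ w) ⊥ᵗ ≡ (l ++ w) ⊥ᵗ ⊎ (x ++ l ++ w) ⊥ᵗ ≻ᵍ (l ++ w) ⊥ᵗ
          u≽lw []      = inj₁ refl
          u≽lw (a ∷ x) = inj₂ (⊥ᵗ-≻ (++-≻ a x (l ++ w)))
          u≻rw : ∀ x → x ++ l ++ w ≻ r ++ w
          u≻rw []      = lw≻rw
          u≻rw (a ∷ x) = ≻-trans (++-≻ a x (l ++ w)) lw≻rw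
          conclusion-entailed : EntailedBelow (union S) C′ (((x ++ r ++ w) ⊥ᵗ ≉ v ⊥ᵗ) ∷ D′)
          conclusion-entailed = fair _ ((x ++ r ++ w ≉ v) ∷ D) (C∈limit ∷ ρs-sound rule ∷ [])
            (rewriting D [] neg x l w v r C∼ ∼.↭-refl (λ _ → selected′) (λ ())
              (noneSelectedIn-[] (selectPremise _)) (ρs-decreasing rule)
              (∼-reflexive (cong (_ ∷_) (sym (++-identityʳ D)))))
            record { premises   = P-GPremise ∷ unit-GPremise l r w ∷ []
                   ; conclusion = negative ∷ gs
                   ; inference  = ground-rewriting P neg x (l ++ w) (r ++ w) (v ⊥ᵗ) D′ C′∼
                       (λ _ → selectedᵍ) (λ ()) lw≻rw ∼.↭-refl }
            (here refl , ≻ᶜ-irrefl C′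
              ∷ ≻ᶜ-asym C′ (unitᵍ (l ++ w) (r ++ w))
                  (negative-≻-unit C′∼ (u≽lw x) (inj₂ (⊥ᵗ-≻ (u≻rw x))))
              ∷ [])

      -- If the selected literal is false, its sides share a normal form: they are identical, or one
      -- of them is reducible.
      selected-true : SatisfiesG model C′
      selected-true with select-negative select≡L
      ... | negative {u} {v} , L∈C with ∈ᶜ⇒∼ L∈C
      ... | D , C∼ with GClause-∼ C∼ g
      ... | _ , negative ∷ gs , C′∼ with nf u ≟ nf v
      ... | no nf≢ = SatisfiesG-∼ model (∼.↭-sym C′∼) λ ¬D → ¬D (here (nf≢ ∘ model-≡⇒nf u v))
      ... | yes nf≡ with u ≟ v | normal⊎reducible u | normal⊎reducible v
      ... | yes u≡v | _          | _          = trivial-true same C∼ gs C′∼ u≡v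
      ... | no _    | inj₂ red-u | _          = reducible-true same C∼ gs C′∼ red-u nf≡
      -- The clause is presented with the selected literal flipped, so that the reducible right side
      -- becomes the rewritten one.
      ... | no _    | inj₁ _     | inj₂ red-v =
        reducible-true flip (↭.trans C∼ (↭.prep flip ∼.↭-refl)) gs
                       (↭.trans C′∼ (↭.prep flip ∼.↭-refl)) red-v (sym nf≡)
      ... | no u≢v  | inj₁ nf-u  | inj₁ nf-v  =
        contradiction (trans (sym nf-u) (trans nf≡ nf-v)) u≢v

    -- Truth of all g-clauses of the derivation

    unit-clause-true : ∀ {s t} → ((s ≈ t) ∷ []) ∈ limit S → ∀ w →
                       TrueBelow (unitᵍ (s ++ w) (t ++ w)) → nf (s ++ w) ≡ nf (t ++ w)
    unit-clause-true {s} {t} st∈ w below with ≻-total s t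
    ... | inj₁ refl       = refl
    ... | inj₂ (inj₁ s≻t) = oriented-true (ρs-complete s≻t st∈) w below
    ... | inj₂ (inj₂ t≻s) = sym (oriented-true
      (ρs-complete t≻s (limit-closed (↭.prep flip ∼.↭-refl) st∈)) w
      (TrueBelow-∼ {unitᵍ (s ++ w) (t ++ w)} (↭.prep flip ∼.↭-refl) below))

    limit-true : ∀ {C C′} → C ∈ limit S → GClause C C′ → TrueBelow C′ → SatisfiesG model C′
    limit-true {C} C∈ g below with definite-cases C (limit-definite C∈)
    limit-true C∈ g below | inj₁ L∈C with select-total L∈C
    ... | _ , select≡L = selected-true C∈ select≡L g below
    limit-true C∈ (positive w ∷ []) below | inj₂ (s , t , refl) = λ ¬st →
      ¬st (here (nf⇒model-≡ (s ++ w) (t ++ w) (unit-clause-true C∈ w below)))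

    union-true : ∀ {C C′} → Acc (F.flip _≻ᶜ_) C′ → C ∈ union S → GClause C C′ → SatisfiesG model C′
    -- Satisfaction is itself a negation, so the doubly negated dichotomy can be applied to the
    -- assumed refutation.
    union-true {C} {C′} (acc rs) (i , C∈Sᵢ) g ¬C′ = limit⊎redundant i C∈Sᵢ λ where
        (inj₁ C∈limit)   → limit-true C∈limit g below ¬C′
        (inj₂ redundant) → entailed-true C′ below (redundant g) ¬C′
      where
      below : TrueBelow C′
      below D∈ h C′≻D′ = union-true (rs C′≻D′) D∈ h

    model-satisfies-R : R ⊆ Satisfies model
    model-satisfies-R C∈R g = union-true (≻ᶜ-wellFounded _) (R⊆union C∈R) g

    -- Soundness and completeness of normal forms

    module _ (I : Interpretation k) (R⊆I : R ⊆ Satisfies I) where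

      -- The left context is handled by congruence, the suffixes `v` and `w` together by the
      -- instance of the rule at `v ++ w`.
      step-sound : ∀ {p q} → step p ≡ just q → ∀ w → _↔ᴵ_ I (p ++ w) (q ++ w)
      step-sound {p} eq w with step-just p eq
      ... | u , x , y , refl , refl , _ , root≡ with contracta-sound ρs (proj₁ (least-just _ root≡))
      ... | contract l r v rule refl refl =
        subst₂ (_↔ᴵ_ I) (sym (reassoc l)) (sym (reassoc r))
          (↔-++ I u (valid-↔ I (valid-head I (limit-sound I R⊆I (ρs-sound rule)) [] λ ()) (v ++ w)))
        where
        reassoc : ∀ s → (u ++ s ++ v) ++ w ≡ u ++ s ++ v ++ w
        reassoc s = trans (++-assoc u (s ++ v) w) (cong (u ++_) (++-assoc s v w))

      ⇓-sound : ∀ {p m} → p ⇓ m → ∀ w → _↔ᴵ_ I (p ++ w) (m ++ w)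
      ⇓-sound (stop _)    w =
        ↔-intro λ ¬p → ¬p (IsEquivalence.refl (Interpretation.isEquivalence I))
      ⇓-sound (go eq q⇓m) w = ↔-trans I (step-sound eq w) (⇓-sound q⇓m w)

    nf-sound : ∀ s t → nf s ≡ nf t → R ⊨ (s ≈ t)
    nf-sound s t nf≡ I R⊆I (positive w ∷ []) ¬st = _↔ᴵ_.↔-elim
      (↔-trans I (⇓-sound I R⊆I (nf-⇓ s) w)
        (↔-sym I (subst (λ m → _↔ᴵ_ I (t ++ w) (m ++ w)) (sym nf≡) (⇓-sound I R⊆I (nf-⇓ t) w))))
      (¬st ∘ here)

    -- The model satisfies `R`, so it would refute an equation between words with different normal
    -- forms, already at the empty suffix.
    nf-complete : ∀ s t → R ⊨ (s ≈ t) → nf s ≡ nf t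
    nf-complete s t R⊨ = subst₂ (λ s t → nf s ≡ nf t) (++-identityʳ s) (++-identityʳ t)
      (unit-true _ _ (R⊨ model model-satisfies-R (positive [] ∷ [])))

    word-problem : ∀ s t → Dec (R ⊨ (s ≈ t))
    word-problem s t = map′ (nf-sound s t) (nf-complete s t) (nf s ≟ nf t)

-- Rules read off from a finite list of clauses

units : ∀ {k} → List (Clause (Word k)) → List (Rule k)
units []                    = []
-- Equations are unoriented, so both directions are listed; the ordering chooses between them later.
units (((s ≈ t) ∷ []) ∷ Cs) = (s , t) ∷ (t , s) ∷ units Cs
units (_ ∷ Cs)              = units Cs

units-sound : ∀ {k} Cs {l r : Word k} → (l , r) ∈ˡ units Cs → Any (((l ≈ r) ∷ []) ∼_) Cs
units-sound (((s ≈ t) ∷ []) ∷ Cs) (here refl)         = here ∼.↭-refl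
units-sound (((s ≈ t) ∷ []) ∷ Cs) (there (here refl)) = here (↭.prep flip ∼.↭-refl)
units-sound (((s ≈ t) ∷ []) ∷ Cs) (there (there p))   = there (units-sound Cs p)
units-sound ([] ∷ Cs)                p = there (units-sound Cs p)
units-sound (((s ≉ t) ∷ []) ∷ Cs)    p = there (units-sound Cs p)
units-sound (((s ≈ t) ∷ _ ∷ _) ∷ Cs) p = there (units-sound Cs p)
units-sound (((s ≉ t) ∷ _ ∷ _) ∷ Cs) p = there (units-sound Cs p)

units-complete : ∀ {k} Cs {l r : Word k} → Any (((l ≈ r) ∷ []) ∼_) Cs → (l , r) ∈ˡ units Cs
-- Permutation preserves length, so `C` is a singleton, and membership identifies its literal up to
-- orientation.
units-complete (C ∷ Cs) (here lr∼C) with C | ∼.xs↭ys⇒|xs|≡|ys| lr∼C | ∼.∈-resp-↭ lr∼C (here same)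
... | (s ≈ t) ∷ [] | _ | here same = here refl
... | (s ≈ t) ∷ [] | _ | here flip = there (here refl)
units-complete (((s ≈ t) ∷ []) ∷ Cs)    (there p) = there (there (units-complete Cs p))
units-complete ([] ∷ Cs)                (there p) = units-complete Cs p
units-complete (((s ≉ t) ∷ []) ∷ Cs)    (there p) = units-complete Cs p
units-complete (((s ≈ t) ∷ _ ∷ _) ∷ Cs) (there p) = units-complete Cs p
units-complete (((s ≉ t) ∷ _ ∷ _) ∷ Cs) (there p) = units-complete Cs p

corollary23 : (k : ℕ) (_<_ : Rel (Fin k) 0ℓ) → IsStrictTotalOrder _≡_ _<_ →
    (sel : Selection k) →
    (let open Saturation _<_ sel) →
    (R : ClauseSet k) → ConditionalEquationalTheory R →
    (n : ℕ) (S : Sequence n) → S zero ≐ R →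
    Derivation S → Fair S → FiniteClauseSet (limit S) →
    (s t : Word k) → Dec (R ⊨ (s ≈ t))
corollary23 k _<_ <-isSTO sel R theory n S S₀≐R derivation fair (Cs , limit≐) =
  -- Only decreasing orientations become rules; an equation between identical words contributes
  -- none.
  word-problem fair (filter (λ (l , r) → l ≻? r) (units Cs))
    (λ p → proj₂ (∈-filter⁻ _ {xs = units Cs} p))
    (λ p → proj₂ limit≐ (units-sound Cs (proj₁ (∈-filter⁻ _ {xs = units Cs} p))))
    (λ l≻r lr∈ → ∈-filter⁺ _ (units-complete Cs (proj₁ limit≐ lr∈)) l≻r)
  where
  open WordOrder _<_ <-isSTO
  open FiniteDerivation _<_ <-isSTO sel theory {S = S} S₀≐R derivation
  open SaturatedLimit
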